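{- Let $d\ge 10$ and let $h_1<h_2<\dots$ be a (finite or infinite, possibly empty) strictly increasing sequence of positive integers with $h_{i+1}-h_i\ge 6$ for all $i$. Then the lattice $L_d(h_1,h_2,\dots)$ is perfect and has minimum $4$.
   Context: For a strictly increasing (finite or infinite, possibly empty) sequence of positive integers $h_1<h_2<\dots$ (called holes) and an integer $d\ge1$, let $s_1<s_2<\dots<s_{d+2}$ be the $d+2$ smallest elements of $\{1,2,3,\dots\}\setminus\{h_1,h_2,\dots\}$, and define $L_d(h_1,h_2,\dots)=\{x\in\mathbb Z^{d+2}:\ \sum_{i=1}^{d+2}x_i=0,\ \sum_{i=1}^{d+2}s_ix_i=0\}$ with the standard inner product of $\mathbb R^{d+2}$; it is an even integral lattice of rank $d$. The minimum is the smallest squared Euclidean norm of a nonzero element. A lattice $L$ of rank $n$ is perfect if $\{v\otimes v\}$, $v$ ranging over its minimal vectors, spans the $\binom{n+1}{2}$-dimensional space of symmetric tensors in $(L\otimes\mathbb R)\otimes(L\otimes\mathbb R)$. -}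

module Defs where

open import Data.Nat as ℕ using (ℕ; _⊔_)
import Data.Nat.Properties as ℕ
open import Data.Integer as ℤ using (ℤ; +_; 0ℤ)
import Data.Integer.Properties as ℤ
open import Data.Rational as ℚ using (ℚ; 0ℚ; 1ℚ; ½)
import Data.Rational.Properties as ℚ
open import Data.Fin as Fin using (Fin)
open import Data.List using (List; foldr)
open import Data.List.Membership.Propositional using (_∈_)
open import Data.List.Relation.Unary.All using (All)
open import Data.List.Relation.Unary.Linked using (Linked)
open import Data.Product using (Σ; ∃; ∃-syntax; _×_; _,_; proj₁)
open import Data.Vec.Functional using (Vector)
open import Level using (0ℓ)
open import Relation.Binary using (Rel)
open import Relation.Binary.PropositionalEquality using (_≡_; refl; sym; trans; cong; cong₂; subst; module ≡-Reasoning)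
open import Relation.Nullary using (¬_)
open import Relation.Unary using (Pred; _≐_; _∩_)

open import Algebra.Bundles using (CommutativeMonoid)
open import Algebra.Properties.AbelianGroup ℚ.+-0-abelianGroup using (⁻¹-∙-comm)
open import Algebra.Properties.CommutativeSemigroup
  (CommutativeMonoid.commutativeSemigroup ℚ.+-0-commutativeMonoid) using (interchange)
open import Algebra.Properties.Ring ℚ.+-*-ring using (x[y-z]≈xy-xz)
open import Algebra.Properties.CommutativeMonoid.Sum ℤ.+-0-commutativeMonoid using (sum)

-- Real numbers: Cauchy sequences of rationals, two of them being
-- identified (by _≈ᵣ_) when their difference tends to zero.

Cauchy : (ℕ → ℚ) → Set
Cauchy x = ∀ ε → 0ℚ ℚ.< ε →
  ∃[ N ] (∀ m n → N ℕ.≤ m → N ℕ.≤ n → ℚ.∣ x m ℚ.- x n ∣ ℚ.< ε)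

record ℝ : Set where
  constructor mkℝ
  field
    approx : ℕ → ℚ
    cauchy : Cauchy approx

open ℝ public

infix  4 _≈ᵣ_
infixl 6 _+ᵣ_
infixl 7 _*ᵣ_

_≈ᵣ_ : Rel ℝ 0ℓ
x ≈ᵣ y = ∀ ε → 0ℚ ℚ.< ε →
  ∃[ N ] (∀ n → N ℕ.≤ n → ℚ.∣ approx x n ℚ.- approx y n ∣ ℚ.< ε)

private
  telescope : ∀ p q r → p ℚ.- r ≡ (p ℚ.- q) ℚ.+ (q ℚ.- r)
  telescope p q r = sym (begin
    (p ℚ.- q) ℚ.+ (q ℚ.- r)          ≡⟨ ℚ.+-assoc p (ℚ.- q) (q ℚ.- r) ⟩
    p ℚ.+ (ℚ.- q ℚ.+ (q ℚ.- r))      ≡⟨ cong (p ℚ.+_) (ℚ.+-assoc (ℚ.- q) q (ℚ.- r)) ⟨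
    p ℚ.+ ((ℚ.- q ℚ.+ q) ℚ.- r)      ≡⟨ cong (λ t → p ℚ.+ (t ℚ.- r)) (ℚ.+-inverseˡ q) ⟩
    p ℚ.+ (0ℚ ℚ.- r)                 ≡⟨ cong (p ℚ.+_) (ℚ.+-identityˡ (ℚ.- r)) ⟩
    p ℚ.- r ∎)
    where open ≡-Reasoning

  sum-difference : ∀ a b c d → (a ℚ.+ b) ℚ.- (c ℚ.+ d) ≡ (a ℚ.- c) ℚ.+ (b ℚ.- d)
  sum-difference a b c d = trans
    (cong ((a ℚ.+ b) ℚ.+_) (sym (⁻¹-∙-comm c d)))
    (interchange a b (ℚ.- c) (ℚ.- d))

  product-difference : ∀ a b c d →
    a ℚ.* b ℚ.- c ℚ.* d ≡ a ℚ.* (b ℚ.- d) ℚ.+ d ℚ.* (a ℚ.- c)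
  product-difference a b c d = trans
    (telescope (a ℚ.* b) (a ℚ.* d) (c ℚ.* d))
    (cong₂ ℚ._+_ (sym (x[y-z]≈xy-xz a b d)) (sym (trans (x[y-z]≈xy-xz d a c)
      (cong₂ ℚ._-_ (ℚ.*-comm d a) (ℚ.*-comm d c)))))

  cauchy-const : ∀ q → Cauchy (λ _ → q)
  cauchy-const q ε 0<ε =
    0 , λ _ _ _ _ → subst (λ r → ℚ.∣ r ∣ ℚ.< ε) (sym (ℚ.+-inverseʳ q)) 0<ε

  cauchy-+ : ∀ x y → Cauchy x → Cauchy y → Cauchy (λ n → x n ℚ.+ y n)
  cauchy-+ x y cx cy ε 0<ε
    with cx (½ ℚ.* ε) 0<½ε | cy (½ ℚ.* ε) 0<½ε
    where
    0<½ε : 0ℚ ℚ.< ½ ℚ.* ε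
    0<½ε = ℚ.*-monoʳ-<-pos ½ 0<ε
  ... | M , hx | N , hy = M ⊔ N , λ m n p q → begin-strict
    ℚ.∣ (x m ℚ.+ y m) ℚ.- (x n ℚ.+ y n) ∣
      ≡⟨ cong ℚ.∣_∣ (sum-difference (x m) (y m) (x n) (y n)) ⟩
    ℚ.∣ (x m ℚ.- x n) ℚ.+ (y m ℚ.- y n) ∣
      ≤⟨ ℚ.∣p+q∣≤∣p∣+∣q∣ (x m ℚ.- x n) (y m ℚ.- y n) ⟩
    ℚ.∣ x m ℚ.- x n ∣ ℚ.+ ℚ.∣ y m ℚ.- y n ∣
      <⟨ ℚ.+-mono-<
           (hx m n (ℕ.m⊔n≤o⇒m≤o M N p) (ℕ.m⊔n≤o⇒m≤o M N q))
           (hy m n (ℕ.m⊔n≤o⇒n≤o M N p) (ℕ.m⊔n≤o⇒n≤o M N q)) ⟩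
    ½ ℚ.* ε ℚ.+ ½ ℚ.* ε
      ≡⟨ sym (ℚ.*-distribʳ-+ ε ½ ½) ⟩
    1ℚ ℚ.* ε
      ≡⟨ ℚ.*-identityˡ ε ⟩
    ε ∎
    where
    open ℚ.≤-Reasoning

  cauchy-bounded : ∀ x → Cauchy x →
    ∃[ B ] 0ℚ ℚ.< B × ∃[ N ] (∀ n → N ℕ.≤ n → ℚ.∣ x n ∣ ℚ.≤ B)
  cauchy-bounded x cx with cx 1ℚ (ℚ.positive⁻¹ 1ℚ)
  ... | N , h = 1ℚ ℚ.+ ℚ.∣ x N ∣
    , ℚ.+-mono-<-≤ (ℚ.positive⁻¹ 1ℚ) (ℚ.0≤∣p∣ (x N))
    , N , λ n p → begin
      ℚ.∣ x n ∣
        ≡⟨ cong ℚ.∣_∣ (split (x n) (x N)) ⟩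
      ℚ.∣ (x n ℚ.- x N) ℚ.+ x N ∣
        ≤⟨ ℚ.∣p+q∣≤∣p∣+∣q∣ (x n ℚ.- x N) (x N) ⟩
      ℚ.∣ x n ℚ.- x N ∣ ℚ.+ ℚ.∣ x N ∣
        ≤⟨ ℚ.+-monoˡ-≤ ℚ.∣ x N ∣ (ℚ.<⇒≤ (h n N p ℕ.≤-refl)) ⟩
      1ℚ ℚ.+ ℚ.∣ x N ∣ ∎
    where
    open ℚ.≤-Reasoning
    split : ∀ a b → a ≡ (a ℚ.- b) ℚ.+ b
    split a b = sym (trans (ℚ.+-assoc a (ℚ.- b) b)
      (trans (cong (a ℚ.+_) (ℚ.+-inverseˡ b)) (ℚ.+-identityʳ a)))

  cauchy-* : ∀ x y → Cauchy x → Cauchy y → Cauchy (λ n → x n ℚ.* y n)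
  cauchy-* x y cx cy ε 0<ε with cauchy-bounded x cx | cauchy-bounded y cy
  ... | A , 0<A , K , bx | B , 0<B , L , by = (K ⊔ L) ⊔ (M ⊔ N) , bound
    where
    instance
      A⁺ : ℚ.Positive A
      A⁺ = ℚ.positive 0<A
      B⁺ : ℚ.Positive B
      B⁺ = ℚ.positive 0<B
      A+B⁺ : ℚ.Positive (A ℚ.+ B)
      A+B⁺ = ℚ.pos+pos⇒pos A B
      A+B≢0 : ℚ.NonZero (A ℚ.+ B)
      A+B≢0 = ℚ.pos⇒nonZero (A ℚ.+ B)
      ε⁺ : ℚ.Positive ε
      ε⁺ = ℚ.positive 0<ε
      A+B⁻¹⁺ : ℚ.Positive (ℚ.1/ (A ℚ.+ B))
      A+B⁻¹⁺ = ℚ.1/pos⇒pos (A ℚ.+ B)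

    δ : ℚ
    δ = ℚ.1/ (A ℚ.+ B) ℚ.* ε

    0<δ : 0ℚ ℚ.< δ
    0<δ = ℚ.positive⁻¹ δ {{ℚ.pos*pos⇒pos (ℚ.1/ (A ℚ.+ B)) ε}}

    M N : ℕ
    M = proj₁ (cx δ 0<δ)
    N = proj₁ (cy δ 0<δ)

    open ℚ.≤-Reasoning

    product-bound : ∀ {C} .{{_ : ℚ.Positive C}} a b →
      ℚ.∣ a ∣ ℚ.≤ C → ℚ.∣ b ∣ ℚ.< δ → ℚ.∣ a ℚ.* b ∣ ℚ.< C ℚ.* δ
    product-bound {C} a b p q = begin-strict
      ℚ.∣ a ℚ.* b ∣
        ≡⟨ ℚ.∣p*q∣≡∣p∣*∣q∣ a b ⟩
      ℚ.∣ a ∣ ℚ.* ℚ.∣ b ∣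
        ≤⟨ ℚ.*-monoʳ-≤-nonNeg ℚ.∣ b ∣ {{ℚ.∣-∣-nonNeg b}} p ⟩
      C ℚ.* ℚ.∣ b ∣
        <⟨ ℚ.*-monoʳ-<-pos C q ⟩
      C ℚ.* δ ∎

    bound : ∀ m n → (K ⊔ L) ⊔ (M ⊔ N) ℕ.≤ m → (K ⊔ L) ⊔ (M ⊔ N) ℕ.≤ n →
      ℚ.∣ x m ℚ.* y m ℚ.- x n ℚ.* y n ∣ ℚ.< ε
    bound m n p q = begin-strict
      ℚ.∣ x m ℚ.* y m ℚ.- x n ℚ.* y n ∣
        ≡⟨ cong ℚ.∣_∣ (product-difference (x m) (y m) (x n) (y n)) ⟩
      ℚ.∣ x m ℚ.* (y m ℚ.- y n) ℚ.+ y n ℚ.* (x m ℚ.- x n) ∣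
        ≤⟨ ℚ.∣p+q∣≤∣p∣+∣q∣ (x m ℚ.* (y m ℚ.- y n)) (y n ℚ.* (x m ℚ.- x n)) ⟩
      ℚ.∣ x m ℚ.* (y m ℚ.- y n) ∣ ℚ.+ ℚ.∣ y n ℚ.* (x m ℚ.- x n) ∣
        <⟨ ℚ.+-mono-<
             (product-bound (x m) (y m ℚ.- y n) (bx m (≥K p))
               (Σ.proj₂ (cy δ 0<δ) m n (≥N p) (≥N q)))
             (product-bound (y n) (x m ℚ.- x n) (by n (≥L q))
               (Σ.proj₂ (cx δ 0<δ) m n (≥M p) (≥M q))) ⟩
      A ℚ.* δ ℚ.+ B ℚ.* δ
        ≡⟨ sym (ℚ.*-distribʳ-+ δ A B) ⟩
      (A ℚ.+ B) ℚ.* δ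
        ≡⟨ sym (ℚ.*-assoc (A ℚ.+ B) (ℚ.1/ (A ℚ.+ B)) ε) ⟩
      ((A ℚ.+ B) ℚ.* ℚ.1/ (A ℚ.+ B)) ℚ.* ε
        ≡⟨ cong (ℚ._* ε) (ℚ.*-inverseʳ (A ℚ.+ B)) ⟩
      1ℚ ℚ.* ε
        ≡⟨ ℚ.*-identityˡ ε ⟩
      ε ∎
      where
      module _ {k} (r : (K ⊔ L) ⊔ (M ⊔ N) ℕ.≤ k) where
        ≥K : K ℕ.≤ k
        ≥K = ℕ.m⊔n≤o⇒m≤o K L (ℕ.m⊔n≤o⇒m≤o (K ⊔ L) (M ⊔ N) r)
        ≥L : L ℕ.≤ k
        ≥L = ℕ.m⊔n≤o⇒n≤o K L (ℕ.m⊔n≤o⇒m≤o (K ⊔ L) (M ⊔ N) r)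
        ≥M : M ℕ.≤ k
        ≥M = ℕ.m⊔n≤o⇒m≤o M N (ℕ.m⊔n≤o⇒n≤o (K ⊔ L) (M ⊔ N) r)
        ≥N : N ℕ.≤ k
        ≥N = ℕ.m⊔n≤o⇒n≤o M N (ℕ.m⊔n≤o⇒n≤o (K ⊔ L) (M ⊔ N) r)

fromℚ : ℚ → ℝ
fromℚ q = mkℝ (λ _ → q) (cauchy-const q)

fromℤ : ℤ → ℝ
fromℤ k = fromℚ (k ℚ./ 1)

0ᵣ : ℝ
0ᵣ = fromℚ 0ℚ

_+ᵣ_ : ℝ → ℝ → ℝ
x +ᵣ y = mkℝ (λ n → approx x n ℚ.+ approx y n)
             (cauchy-+ (approx x) (approx y) (cauchy x) (cauchy y))

_*ᵣ_ : ℝ → ℝ → ℝ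
x *ᵣ y = mkℝ (λ n → approx x n ℚ.* approx y n)
             (cauchy-* (approx x) (approx y) (cauchy x) (cauchy y))

linearCombination : {I A : Set} → (A → I → ℝ) → List (ℝ × A) → I → ℝ
linearCombination f cs i = foldr (λ (c , a) r → c *ᵣ f a i +ᵣ r) 0ᵣ cs

-- The real span, inside ℝᴵ, of a family of vectors indexed by A.
Span : {I A : Set} → (A → I → ℝ) → Pred (I → ℝ) 0ℓ
Span f x = ∃[ cs ] (∀ i → x i ≈ᵣ linearCombination f cs i)

-- ℝⁿ ⊗ ℝⁿ, identified with the n × n matrices.
Tensor : ℕ → Set
Tensor n = Fin n × Fin n → ℝ

infixr 7 _⊗_

_⊗_ : ∀ {n} → Vector ℝ n → Vector ℝ n → Tensor n
(u ⊗ w) (i , j) = u i *ᵣ w j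

SymmetricTensor : ∀ {n} → Pred (Tensor n) 0ℓ
SymmetricTensor t = ∀ i j → t (i , j) ≈ᵣ t (j , i)

-- Sublattices of ℤⁿ, given by their membership predicate.
Lattice : ℕ → Set₁
Lattice n = Pred (Vector ℤ n) 0ℓ

NonZero : ∀ {n} → Pred (Vector ℤ n) 0ℓ
NonZero x = ¬ (∀ i → x i ≡ 0ℤ)

-- Squared Euclidean norm.
norm : ∀ {n} → Vector ℤ n → ℤ
norm x = sum (λ i → x i ℤ.* x i)

IsMinimal : ∀ {n} → Lattice n → Pred (Vector ℤ n) 0ℓ
IsMinimal L v = L v × NonZero v × (∀ x → L x → NonZero x → norm v ℤ.≤ norm x)

HasMinimum : ∀ {n} → Lattice n → ℤ → Set
HasMinimum L m = ∃[ v ] IsMinimal L v × norm v ≡ m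

real : ∀ {n} → Vector ℤ n → Vector ℝ n
real x i = fromℤ (x i)

-- For a sublattice of ℤⁿ, L ⊗ ℝ is its real span in ℝⁿ.
_⊗ℝ : ∀ {n} → Lattice n → Pred (Vector ℝ n) 0ℓ
L ⊗ℝ = Span {A = ∃ L} (λ (x , _) → real x)

-- (L ⊗ ℝ) ⊗ (L ⊗ ℝ) as a subspace of ℝⁿ ⊗ ℝⁿ.
TensorSquare : ∀ {n} → Lattice n → Pred (Tensor n) 0ℓ
TensorSquare L = Span {A = ∃ (L ⊗ℝ) × ∃ (L ⊗ℝ)} (λ ((u , _) , (w , _)) → u ⊗ w)

Perfect : ∀ {n} → Lattice n → Set
Perfect L =
  Span {A = ∃ (IsMinimal L)} (λ (v , _) → real v ⊗ real v)
    ≐ (TensorSquare L ∩ SymmetricTensor)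

data Sequence : Set where
  finite   : List ℕ → Sequence
  infinite : (ℕ → ℕ) → Sequence

_∈ₛ_ : ℕ → Sequence → Set
k ∈ₛ finite hs  = k ∈ hs
k ∈ₛ infinite h = ∃[ i ] k ≡ h i

AllTerms : Pred ℕ 0ℓ → Sequence → Set
AllTerms P (finite hs)  = All P hs
AllTerms P (infinite h) = ∀ i → P (h i)

Consecutive : Rel ℕ 0ℓ → Sequence → Set
Consecutive R (finite hs)  = Linked R hs
Consecutive R (infinite h) = ∀ i → R (h i) (h (ℕ.suc i))

NonHole : Sequence → Pred ℕ 0ℓ
NonHole h k = 0 ℕ.< k × ¬ (k ∈ₛ h)

-- s lists the n smallest positive integers that are not in h, in
-- increasing order.
record SmallestNonHoles (h : Sequence) {n : ℕ} (s : Vector ℕ n) : Set where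
  field
    increasing : ∀ {i j} → i Fin.< j → s i ℕ.< s j
    nonHole    : ∀ i → NonHole h (s i)
    smallest   : ∀ {k} j → NonHole h k → k ℕ.≤ s j → ∃[ i ] k ≡ s i

-- SmallestNonHoles h determines s pointwise, so the existential only
-- names it; if h had too few non-holes, the set would be empty.
L[_] : (d : ℕ) → Sequence → Lattice (2 ℕ.+ d)
L[ d ] h x =
  sum x ≡ 0ℤ ×
  ∃[ s ] SmallestNonHoles h s × sum (λ i → + s i ℤ.* x i) ≡ 0ℤ

{-# OPTIONS --safe #-}

-- A minimal vector is a "corner" e_w + e_x − e_y − e_z with w + x = y + z: parity and the two
-- linear relations exclude smaller norms. Perfection means that every saturated (pure) subgroup P
-- of integer matrices containing v ⊙ v for all corners v contains x ⊙ y for all x, y in the lattice.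
-- This is shown by adding the non-holes from the top downwards, starting with the last twelve.
-- Base: only 34 patterns of twelve consecutive non-holes exist, and for each of them
-- a verified Gaussian elimination shows that the corner equations have full rank.
-- Step: fix one corner v₀ through the new non-hole m. By polarisation v₀ ⊙ v lies in P for every
-- corner v through m, so the x with v₀ ⊙ x ∈ P form a pure subgroup containing these corners;
-- elimination on the twelve non-holes from m on, and then propagation along further corners
-- through m, shows that it contains the lattice.
module Submission where

open import Defs
open import Data.Bool using (Bool; true; false; if_then_else_; _∧_; T)
open import Data.Fin as Fin using (zero; suc; punchIn; toℕ)
import Data.Fin.Induction as Fin
import Data.Fin.Properties as Fin
open import Data.Integer as ℤ using (ℤ; +_; 0ℤ; 1ℤ; -1ℤ)
import Data.Integer.Properties as ℤ
open import Data.Integer.Tactic.RingSolver using (solve-∀)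
open import Data.List as List using (List; []; _∷_; _++_; concatMap)
open import Data.List.Membership.Propositional using (_∈_)
import Data.List.Membership.Propositional.Properties as ∈
open import Data.List.Relation.Unary.All as All using (All; []; _∷_)
import Data.List.Relation.Unary.All.Properties as All
open import Data.List.Relation.Unary.AllPairs using (AllPairs; []; _∷_)
open import Data.List.Relation.Unary.Any using (here; there)
open import Data.List.Relation.Unary.Linked.Properties using (Linked⇒AllPairs)
open import Data.Maybe as Maybe using (Maybe; just; nothing)
open import Data.Nat as ℕ using (ℕ; zero; suc; _+_; _∸_; _<_; _≤_; z≤n; s≤s; _⊔_)
import Data.Nat.Properties as ℕ
open import Data.List.Membership.DecPropositional ℕ._≟_ using (_∈?_)
import Data.Nat.Tactic.RingSolver as ℕ-Solver
open import Data.Product using (∃; ∃-syntax; ∃₂; _×_; _,_; proj₁; proj₂; map₁)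
open import Data.Rational as ℚ using (ℚ; 0ℚ; 1ℚ; ½)
import Data.Rational.Properties as ℚ
open import Data.Rational.Unnormalised as ℚᵘ using (mkℚᵘ; *≡*)
import Data.Rational.Unnormalised.Properties as ℚᵘ
open import Data.Sum using (_⊎_; inj₁; inj₂)
open import Data.Vec as Vec using (Vec; []; _∷_)
open import Data.Vec.Functional using (Vector; removeAt)
open import Data.Vec.Relation.Unary.All as VecAll using ([]; _∷_)
import Data.Vec.Relation.Unary.All.Properties as VecAll
open import Function using (_∘_)
open import Level using (0ℓ)
open import Relation.Binary.Definitions using (tri<; tri≈; tri>)
open import Relation.Binary.PropositionalEquality
open import Relation.Nullary using (¬_; yes; no; contradiction)
open import Relation.Nullary.Decidable using (Dec; _×-dec_; dec⇒maybe; map′)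
open import Relation.Unary using (Pred; Decidable; _⊆_; _∩_)
open import Algebra.Properties.Semiring.Sum ℤ.+-*-semiring
  using (sum; sum-remove; sum-cong-≗; sum-replicate-zero; ∑-distrib-+; *-distribˡ-sum)
import Tactic.RingSolver as RingSolver
open import Tactic.RingSolver.Core.AlmostCommutativeRing using (AlmostCommutativeRing; fromCommutativeRing)

-- Whether a pivot vanishes cannot be decided for Cauchy reals, so elimination runs on
-- integer-valued functions of positions: purity stands in for division, and a real subspace enters
-- through its integer points. The unknowns are the functions E_p, namely δ_p minus its affine
-- interpolation at two fixed non-holes a < b, multiplied by b - a. They satisfy both linear
-- relations, E_a and E_b are zero, and (b - a) times a corner is E_w + E_x - E_y - E_z. These
-- coefficients depend only on the pattern of offsets, not on where the window lies, which is why
-- finitely many eliminations suffice: 10 unknowns for the corners through the lowest point, 55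
-- products of two for the squares. Twelve is the number d + 2 of non-holes in the smallest case d =
-- 10. In the step, v - v₀ no longer involves m, so the induction hypothesis covers its square.
-- Conversely, a nonzero multiple of any lattice vector is a multiple of v₀ plus a vector supported
-- above m, so controlling products with v₀ is all that the new non-hole requires.

-- Pure subgroups of integer-valued functions

record PureSubgroup {I : Set} (P : Pred (I → ℤ) 0ℓ) : Set where
  field
    respects : ∀ {f g} → f ≗ g → P f → P g
    zero∈    : P (λ _ → 0ℤ)
    linear   : ∀ α β {f g} → P f → P g → P (λ i → α ℤ.* f i ℤ.+ β ℤ.* g i)
    pure     : ∀ {α f} → α ≢ 0ℤ → P (λ i → α ℤ.* f i) → P f

  scaled : ∀ α {f} → P f → P (λ i → α ℤ.* f i)
  scaled α f∈ = respects (λ _ → ℤ.+-identityʳ _) (linear α 0ℤ f∈ f∈)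

open PureSubgroup

-- Gaussian elimination over ℤ

combine : ∀ {n} → ℤ → ℤ → Vec ℤ n → Vec ℤ n → Vec ℤ n
combine α β = Vec.zipWith (λ a b → α ℤ.* a ℤ.+ β ℤ.* b)

dot : ∀ {I : Set} {n} → Vec ℤ n → Vec (I → ℤ) n → I → ℤ
dot []       []       i = 0ℤ
dot (c ∷ cs) (u ∷ us) i = c ℤ.* u i ℤ.+ dot cs us i

dot-combine : ∀ {I : Set} {n} α β (cs ds : Vec ℤ n) (us : Vec (I → ℤ) n) i →
  dot (combine α β cs ds) us i ≡ α ℤ.* dot cs us i ℤ.+ β ℤ.* dot ds us i
dot-combine α β [] [] [] i = lemma α β
  where
  lemma : ∀ α β → 0ℤ ≡ α ℤ.* 0ℤ ℤ.+ β ℤ.* 0ℤ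
  lemma = solve-∀
dot-combine α β (c ∷ cs) (d ∷ ds) (u ∷ us) i = trans
  (cong (λ t → (α ℤ.* c ℤ.+ β ℤ.* d) ℤ.* u i ℤ.+ t) (dot-combine α β cs ds us i))
  (lemma α β c d (u i) (dot cs us i) (dot ds us i))
  where
  lemma : ∀ α β c d u s t → (α ℤ.* c ℤ.+ β ℤ.* d) ℤ.* u ℤ.+ (α ℤ.* s ℤ.+ β ℤ.* t) ≡
    α ℤ.* (c ℤ.* u ℤ.+ s) ℤ.+ β ℤ.* (d ℤ.* u ℤ.+ t)
  lemma = solve-∀

dot-zero : ∀ {I : Set} {n} (us : Vec (I → ℤ) n) i → dot (Vec.replicate n 0ℤ) us i ≡ 0ℤ
dot-zero []       i = refl
dot-zero (u ∷ us) i = trans (ℤ.+-identityˡ _) (dot-zero us i)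

-- The two special cases keep the entries small during the elimination. Their equality proofs
-- are not matched against refl, since evaluating them is linear in the size of the entries.
multipliers : ∀ p r → ∃₂ λ α β → α ℤ.* r ℤ.+ β ℤ.* p ≡ 0ℤ
multipliers p r with p ℤ.≟ r | p ℤ.≟ ℤ.- r
... | yes p≡r | _ = 1ℤ , -1ℤ , trans (cong (λ t → 1ℤ ℤ.* r ℤ.+ -1ℤ ℤ.* t) p≡r) (lemma r)
  where
  lemma : ∀ r → 1ℤ ℤ.* r ℤ.+ -1ℤ ℤ.* r ≡ 0ℤ
  lemma = solve-∀
... | no _ | yes p≡-r = 1ℤ , 1ℤ , trans (cong (λ t → 1ℤ ℤ.* r ℤ.+ 1ℤ ℤ.* t) p≡-r) (lemma r)
  where
  lemma : ∀ r → 1ℤ ℤ.* r ℤ.+ 1ℤ ℤ.* (ℤ.- r) ≡ 0ℤ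
  lemma = solve-∀
... | no _ | no _ = p , ℤ.- r , lemma p r
  where
  lemma : ∀ p r → p ℤ.* r ℤ.+ (ℤ.- r) ℤ.* p ≡ 0ℤ
  lemma = solve-∀

eliminate : ∀ {n} → Vec ℤ (suc n) → Vec ℤ (suc n) → Vec ℤ n
eliminate (p ∷ ps) (r ∷ rs) with r ℤ.≟ 0ℤ
... | yes _ = rs
... | no _  = let α , β , _ = multipliers p r in combine α β rs ps

pivot : ∀ {n} (rows : List (Vec ℤ (suc n))) →
  Maybe (∃[ row ] row ∈ rows × Vec.head row ≢ 0ℤ)
pivot [] = nothing
pivot (row ∷ rows) with Vec.head row ℤ.≟ 0ℤ
... | no ≢0 = just (row , here refl , ≢0)
... | yes _ = Maybe.map (λ (row , row∈ , ≢0) → row , there row∈ , ≢0) (pivot rows)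

-- The pivot row stays in the list: it eliminates itself to the zero row, which can never become a
-- pivot again.
hasFullRank : ∀ {n} → List (Vec ℤ n) → Bool
hasFullRank {zero}  rows = true
hasFullRank {suc n} rows with pivot rows
... | nothing        = false
... | just (row , _) = hasFullRank (List.map (eliminate row) rows)

module _ {I : Set} {P : Pred (I → ℤ) 0ℓ} (isPure : PureSubgroup P) where

  dot∈ : ∀ {n} (cs : Vec ℤ n) {us} → VecAll.All P us → P (dot cs us)
  dot∈ []       []         = zero∈ isPure
  dot∈ (c ∷ cs) {u ∷ us} (u∈ ∷ us∈) = respects isPure
    (λ i → cong (λ t → c ℤ.* u i ℤ.+ t) (ℤ.*-identityˡ (dot cs us i)))
    (linear isPure c 1ℤ u∈ (dot∈ cs us∈))

  eliminate∈ : ∀ {n} (p r : Vec ℤ (suc n)) {u us} →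
    P (dot p (u ∷ us)) → P (dot r (u ∷ us)) → P (dot (eliminate p r) us)
  eliminate∈ (p ∷ ps) (r ∷ rs) {u} {us} p∈ r∈ with r ℤ.≟ 0ℤ
  ... | yes refl = respects isPure (λ i → ℤ.+-identityˡ (dot rs us i)) r∈
  ... | no _     =
    let α , β , cancels = multipliers p r in
    respects isPure (λ i → trans
      (lemma α β p r (u i) (dot ps us i) (dot rs us i) cancels)
      (sym (dot-combine α β rs ps us i))) (linear isPure α β r∈ p∈)
    where
    expand : ∀ α β p r u s t → α ℤ.* (r ℤ.* u ℤ.+ t) ℤ.+ β ℤ.* (p ℤ.* u ℤ.+ s) ≡
      (α ℤ.* r ℤ.+ β ℤ.* p) ℤ.* u ℤ.+ (α ℤ.* t ℤ.+ β ℤ.* s)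
    expand = solve-∀
    lemma : ∀ α β p r u s t → α ℤ.* r ℤ.+ β ℤ.* p ≡ 0ℤ →
      α ℤ.* (r ℤ.* u ℤ.+ t) ℤ.+ β ℤ.* (p ℤ.* u ℤ.+ s) ≡ α ℤ.* t ℤ.+ β ℤ.* s
    lemma α β p r u s t e = trans (expand α β p r u s t)
      (trans (cong (λ z → z ℤ.* u ℤ.+ (α ℤ.* t ℤ.+ β ℤ.* s)) e) (ℤ.+-identityˡ _))

  -- Back substitution: the recursive call puts the later unknowns in `P`, subtracting them from the
  -- pivot row leaves `p` times the first unknown, and purity divides by `p`.
  fullRank⇒all∈ : ∀ {n} (rows : List (Vec ℤ n)) (us : Vec (I → ℤ) n) →
    hasFullRank rows ≡ true → All (λ row → P (dot row us)) rows → VecAll.All P us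
  fullRank⇒all∈ rows []       full rows∈ = []
  fullRank⇒all∈ rows (u ∷ us) full rows∈ with pivot rows
  fullRank⇒all∈ rows (u ∷ us) ()   rows∈ | nothing
  fullRank⇒all∈ rows (u ∷ us) full rows∈ | just (p ∷ ps , row∈ , p≢0) =
    pure isPure p≢0 (respects isPure cancel (linear isPure 1ℤ -1ℤ p∈ (dot∈ ps us∈))) ∷ us∈
    where
    p∈ = All.lookup rows∈ row∈
    us∈ = fullRank⇒all∈ (List.map (eliminate (p ∷ ps)) rows) us full
      (All.map⁺ (All.map (λ {r} → eliminate∈ (p ∷ ps) r p∈) rows∈))
    lemma : ∀ x y → 1ℤ ℤ.* (x ℤ.+ y) ℤ.+ -1ℤ ℤ.* y ≡ x
    lemma = solve-∀
    cancel : ∀ i → 1ℤ ℤ.* dot (p ∷ ps) (u ∷ us) i ℤ.+ -1ℤ ℤ.* dot ps us i ≡ p ℤ.* u i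
    cancel i = lemma (p ℤ.* u i) (dot ps us i)

-- Symmetric products

infixr 7 _⊙_

-- The symmetrised tensor product without the factor 1/2, so that it stays integral; `x ⊙ x` is
-- twice the tensor square.
_⊙_ : {I : Set} → (I → ℤ) → (I → ℤ) → I × I → ℤ
(x ⊙ y) (i , j) = x i ℤ.* y j ℤ.+ y i ℤ.* x j

⊙-comm : {I : Set} (x y : I → ℤ) → x ⊙ y ≗ y ⊙ x
⊙-comm x y (i , j) = ℤ.+-comm (x i ℤ.* y j) (y i ℤ.* x j)

⊙-cong : {I : Set} {x x′ y y′ : I → ℤ} → x ≗ x′ → y ≗ y′ → x ⊙ y ≗ x′ ⊙ y′
⊙-cong p q (i , j) = cong₂ ℤ._+_ (cong₂ ℤ._*_ (p i) (q j)) (cong₂ ℤ._*_ (q i) (p j))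

⊙-pure : {I : Set} {P : Pred (I × I → ℤ) 0ℓ} → PureSubgroup P →
  ∀ x → PureSubgroup (λ y → P (x ⊙ y))
⊙-pure P-pure x = record
  { respects = λ f≗g → respects P-pure (⊙-cong {x = x} {x} (λ _ → refl) f≗g)
  ; zero∈    = respects P-pure (λ (i , j) → sym (zeroʳ (x i) (x j))) (zero∈ P-pure)
  ; linear   = λ α β {f} {g} f∈ g∈ → respects P-pure
      (λ (i , j) → linearʳ α β (x i) (x j) (f i) (f j) (g i) (g j)) (linear P-pure α β f∈ g∈)
  ; pure     = λ {α} {f} α≢0 αf∈ → pure P-pure α≢0
      (respects P-pure (λ (i , j) → scaleʳ α (x i) (x j) (f i) (f j)) αf∈)
  }
  where
  zeroʳ : ∀ x x′ → x ℤ.* 0ℤ ℤ.+ 0ℤ ℤ.* x′ ≡ 0ℤ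
  zeroʳ = solve-∀
  linearʳ : ∀ α β x x′ f f′ g g′ →
    α ℤ.* (x ℤ.* f′ ℤ.+ f ℤ.* x′) ℤ.+ β ℤ.* (x ℤ.* g′ ℤ.+ g ℤ.* x′) ≡
    x ℤ.* (α ℤ.* f′ ℤ.+ β ℤ.* g′) ℤ.+ (α ℤ.* f ℤ.+ β ℤ.* g) ℤ.* x′
  linearʳ = solve-∀
  scaleʳ : ∀ α x x′ f f′ →
    x ℤ.* (α ℤ.* f′) ℤ.+ (α ℤ.* f) ℤ.* x′ ≡ α ℤ.* (x ℤ.* f′ ℤ.+ f ℤ.* x′)
  scaleʳ = solve-∀

triangle : ℕ → ℕ
triangle zero    = 0
triangle (suc n) = suc n + triangle n

products : {I : Set} {n : ℕ} → Vec (I → ℤ) n → Vec (I × I → ℤ) (triangle n)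
products []       = []
products (u ∷ us) = Vec.map (u ⊙_) (u ∷ us) Vec.++ products us

-- Coefficients of the square of a linear form. `products` lists every unordered pair of unknowns
-- once, hence the factor 2 off the diagonal.
squareCoefficients : ∀ {n} → Vec ℤ n → Vec ℤ (triangle n)
squareCoefficients []       = []
squareCoefficients (c ∷ cs) =
  (c ℤ.* c ∷ Vec.map (λ d → + 2 ℤ.* (c ℤ.* d)) cs) Vec.++ squareCoefficients cs

dot-++ : ∀ {I : Set} {m n} (cs : Vec ℤ m) (ds : Vec ℤ n) (us : Vec (I → ℤ) m) vs i →
  dot (cs Vec.++ ds) (us Vec.++ vs) i ≡ dot cs us i ℤ.+ dot ds vs i
dot-++ []       ds []       vs i = sym (ℤ.+-identityˡ _)
dot-++ (c ∷ cs) ds (u ∷ us) vs i =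
  trans (cong (ℤ._+_ (c ℤ.* u i)) (dot-++ cs ds us vs i)) (sym (ℤ.+-assoc (c ℤ.* u i) _ _))

dot-square : ∀ {I : Set} {n} (cs : Vec ℤ n) (us : Vec (I → ℤ) n) →
  dot (squareCoefficients cs) (products us) ≗ dot cs us ⊙ dot cs us
dot-square []       []       ij = refl
dot-square (c ∷ cs) (u ∷ us) ij@(i , j) = begin
  c ℤ.* c ℤ.* (u ⊙ u) ij ℤ.+ dot (Vec.map (λ d → + 2 ℤ.* (c ℤ.* d)) cs Vec.++ squareCoefficients cs)
    (Vec.map (u ⊙_) us Vec.++ products us) ij
    ≡⟨ cong (λ t → c ℤ.* c ℤ.* (u ⊙ u) ij ℤ.+ t)
         (dot-++ (Vec.map (λ d → + 2 ℤ.* (c ℤ.* d)) cs) (squareCoefficients cs) (Vec.map (u ⊙_) us) (products us) ij) ⟩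
  c ℤ.* c ℤ.* (u ⊙ u) ij ℤ.+ (dot (Vec.map (λ d → + 2 ℤ.* (c ℤ.* d)) cs) (Vec.map (u ⊙_) us) ij
    ℤ.+ dot (squareCoefficients cs) (products us) ij)
    ≡⟨ cong₂ (λ s t → c ℤ.* c ℤ.* (u ⊙ u) ij ℤ.+ (s ℤ.+ t)) (mixed cs us) (dot-square cs us ij) ⟩
  c ℤ.* c ℤ.* (u ⊙ u) ij ℤ.+ (+ 2 ℤ.* c ℤ.* (u ⊙ dot cs us) ij ℤ.+ (dot cs us ⊙ dot cs us) ij)
    ≡⟨ expand c (u i) (u j) (dot cs us i) (dot cs us j) ⟩
  (dot (c ∷ cs) (u ∷ us) ⊙ dot (c ∷ cs) (u ∷ us)) ij ∎
  where
  open ≡-Reasoning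
  expand : ∀ c u u′ r r′ →
    c ℤ.* c ℤ.* (u ℤ.* u′ ℤ.+ u ℤ.* u′) ℤ.+ (+ 2 ℤ.* c ℤ.* (u ℤ.* r′ ℤ.+ r ℤ.* u′) ℤ.+ (r ℤ.* r′ ℤ.+ r ℤ.* r′)) ≡
    (c ℤ.* u ℤ.+ r) ℤ.* (c ℤ.* u′ ℤ.+ r′) ℤ.+ (c ℤ.* u ℤ.+ r) ℤ.* (c ℤ.* u′ ℤ.+ r′)
  expand = solve-∀
  mixedZero : ∀ c u u′ → 0ℤ ≡ + 2 ℤ.* c ℤ.* (u ℤ.* 0ℤ ℤ.+ 0ℤ ℤ.* u′)
  mixedZero = solve-∀
  mixedStep : ∀ c u u′ d v v′ r r′ →
    + 2 ℤ.* (c ℤ.* d) ℤ.* (u ℤ.* v′ ℤ.+ v ℤ.* u′) ℤ.+ + 2 ℤ.* c ℤ.* (u ℤ.* r′ ℤ.+ r ℤ.* u′) ≡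
    + 2 ℤ.* c ℤ.* (u ℤ.* (d ℤ.* v′ ℤ.+ r′) ℤ.+ (d ℤ.* v ℤ.+ r) ℤ.* u′)
  mixedStep = solve-∀
  mixed : ∀ {n} (ds : Vec ℤ n) vs →
    dot (Vec.map (λ d → + 2 ℤ.* (c ℤ.* d)) ds) (Vec.map (u ⊙_) vs) ij ≡ + 2 ℤ.* c ℤ.* (u ⊙ dot ds vs) ij
  mixed []       []       = mixedZero c (u i) (u j)
  mixed (d ∷ ds) (v ∷ vs) = trans
    (cong (ℤ._+_ (+ 2 ℤ.* (c ℤ.* d) ℤ.* (u ⊙ v) ij)) (mixed ds vs))
    (mixedStep c (u i) (u j) d (v i) (v j) (dot ds vs i) (dot ds vs j))

products∈ : ∀ {A I : Set} {P : Pred (I × I → ℤ) 0ℓ} → PureSubgroup P →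
  (f : A → I → ℤ) (as : List A) → VecAll.All P (products (Vec.map f (Vec.fromList as))) →
  ∀ {a b} → a ∈ as → b ∈ as → P (f a ⊙ f b)
products∈ {P = P} P-pure f (a₀ ∷ as) ps = go
  where
  split = VecAll.++⁻ (Vec.map (f a₀ ⊙_) (Vec.map f (Vec.fromList (a₀ ∷ as)))) ps
  first : ∀ (bs : List _) → VecAll.All P (Vec.map (f a₀ ⊙_) (Vec.map f (Vec.fromList bs))) →
    ∀ {b} → b ∈ bs → P (f a₀ ⊙ f b)
  first (_ ∷ bs) (p ∷ _)  (here refl) = p
  first (_ ∷ bs) (_ ∷ ps) (there b∈)  = first bs ps b∈
  row = λ {b} → first (a₀ ∷ as) (proj₁ split) {b}
  go : ∀ {a b} → a ∈ a₀ ∷ as → b ∈ a₀ ∷ as → P (f a ⊙ f b)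
  go (here refl) b∈          = row b∈
  go a∈@(there _) (here refl) = respects P-pure (⊙-comm (f a₀) _) (row a∈)
  go (there a∈) (there b∈)   = products∈ P-pure f as (proj₂ split) a∈ b∈

-- Finitely supported functions with their zeroth and first moments

Combination : Set
Combination = List (ℤ × ℕ)

weigh : (ℕ → ℤ) → Combination → ℤ
weigh f []             = 0ℤ
weigh f ((c , p) ∷ cs) = c ℤ.* f p ℤ.+ weigh f cs

δ : ℕ → ℕ → ℤ
δ p i = if p ℕ.≡ᵇ i then 1ℤ else 0ℤ

⟦_⟧ : Combination → ℕ → ℤ
⟦ cs ⟧ i = weigh (λ p → δ p i) cs

total moment : Combination → ℤ
total  = weigh (λ _ → 1ℤ)
moment = weigh (λ p → + p)

infixr 7 _∙_

_∙_ : ℤ → Combination → Combination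
α ∙ cs = List.map (map₁ (α ℤ.*_)) cs

∙-support : ∀ {R : Pred ℕ 0ℓ} α {cs} → All (R ∘ proj₂) cs → All (R ∘ proj₂) (α ∙ cs)
∙-support α = All.map⁺

weigh-++ : ∀ f cs ds → weigh f (cs ++ ds) ≡ weigh f cs ℤ.+ weigh f ds
weigh-++ f []             ds = sym (ℤ.+-identityˡ _)
weigh-++ f ((c , p) ∷ cs) ds = trans (cong (ℤ._+_ (c ℤ.* f p)) (weigh-++ f cs ds))
  (sym (ℤ.+-assoc (c ℤ.* f p) _ _))

weigh-∙ : ∀ f α cs → weigh f (α ∙ cs) ≡ α ℤ.* weigh f cs
weigh-∙ f α []             = sym (ℤ.*-zeroʳ α)
weigh-∙ f α ((c , p) ∷ cs) = trans (cong (ℤ._+_ (α ℤ.* c ℤ.* f p)) (weigh-∙ f α cs))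
  (lemma α c (f p) (weigh f cs))
  where
  lemma : ∀ α c x y → α ℤ.* c ℤ.* x ℤ.+ α ℤ.* y ≡ α ℤ.* (c ℤ.* x ℤ.+ y)
  lemma = solve-∀

-- δ_p minus its affine interpolation at a and b, scaled by b - a
interpolationError : ℕ → ℕ → ℕ → Combination
interpolationError a b p =
  (+ b ℤ.- + a , p) ∷ (+ p ℤ.- + b , a) ∷ (+ a ℤ.- + p , b) ∷ []

module _ {Q : Pred (ℕ → ℤ) 0ℓ} (Q-pure : PureSubgroup Q) where

  weigh∈ : (f : ℕ → ℕ → ℤ) (cs : Combination) → All (λ (_ , p) → Q (f p)) cs →
    Q (λ i → weigh (λ p → f p i) cs)
  weigh∈ f []             []        = zero∈ Q-pure
  weigh∈ f ((c , p) ∷ cs) (q ∷ qs) = respects Q-pure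
    (λ i → cong (λ t → c ℤ.* f p i ℤ.+ t) (ℤ.*-identityˡ _))
    (linear Q-pure c 1ℤ q (weigh∈ f cs qs))

  -- Summing the interpolation errors with the coefficients of `cs` gives (b - a) `⟦ cs ⟧` plus
  -- multiples of δ_a and δ_b that depend only on the two moments. When these vanish, only (b - a)
  -- `⟦ cs ⟧` remains, and purity divides by b - a.
  relation∈ : ∀ {a b} → a ≢ b → (cs : Combination) →
    All (λ (_ , p) → Q ⟦ interpolationError a b p ⟧) cs →
    total cs ≡ 0ℤ → moment cs ≡ 0ℤ → Q ⟦ cs ⟧
  relation∈ {a} {b} a≢b cs qs total≡0 moment≡0 =
    pure Q-pure (λ b-a≡0 → a≢b (ℤ.+-injective (sym (ℤ.i-j≡0⇒i≡j (+ b) (+ a) b-a≡0))))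
      (respects Q-pure (λ i → trans (identity i cs)
        (vanish (+ a) (+ b) (moment cs) (total cs) (δ a i) (δ b i) ((+ b ℤ.- + a) ℤ.* ⟦ cs ⟧ i) total≡0 moment≡0))
        (weigh∈ _ cs qs))
    where
    zeros : ∀ a b u v → 0ℤ ≡ (b ℤ.- a) ℤ.* 0ℤ ℤ.+ (0ℤ ℤ.- b ℤ.* 0ℤ) ℤ.* u ℤ.+ (a ℤ.* 0ℤ ℤ.- 0ℤ) ℤ.* v
    zeros = solve-∀
    add : ∀ a b p u v w c k m t →
      c ℤ.* ((b ℤ.- a) ℤ.* w ℤ.+ ((p ℤ.- b) ℤ.* u ℤ.+ ((a ℤ.- p) ℤ.* v ℤ.+ 0ℤ))) ℤ.+
      ((b ℤ.- a) ℤ.* k ℤ.+ (m ℤ.- b ℤ.* t) ℤ.* u ℤ.+ (a ℤ.* t ℤ.- m) ℤ.* v) ≡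
      (b ℤ.- a) ℤ.* (c ℤ.* w ℤ.+ k) ℤ.+ ((c ℤ.* p ℤ.+ m) ℤ.- b ℤ.* (c ℤ.* 1ℤ ℤ.+ t)) ℤ.* u
        ℤ.+ (a ℤ.* (c ℤ.* 1ℤ ℤ.+ t) ℤ.- (c ℤ.* p ℤ.+ m)) ℤ.* v
    add = solve-∀
    identity : ∀ i cs → weigh (λ p → ⟦ interpolationError a b p ⟧ i) cs ≡
      (+ b ℤ.- + a) ℤ.* ⟦ cs ⟧ i ℤ.+ (moment cs ℤ.- + b ℤ.* total cs) ℤ.* δ a i
        ℤ.+ (+ a ℤ.* total cs ℤ.- moment cs) ℤ.* δ b i
    identity i [] = zeros (+ a) (+ b) (δ a i) (δ b i)
    identity i ((c , p) ∷ cs) = trans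
      (cong (ℤ._+_ (c ℤ.* ⟦ interpolationError a b p ⟧ i)) (identity i cs))
      (add (+ a) (+ b) (+ p) (δ a i) (δ b i) (δ p i) c (⟦ cs ⟧ i) (moment cs) (total cs))
    drop : ∀ a b u v k → k ℤ.+ (0ℤ ℤ.- b ℤ.* 0ℤ) ℤ.* u ℤ.+ (a ℤ.* 0ℤ ℤ.- 0ℤ) ℤ.* v ≡ k
    drop = solve-∀
    vanish : ∀ a b m t u v k → t ≡ 0ℤ → m ≡ 0ℤ →
      k ℤ.+ (m ℤ.- b ℤ.* t) ℤ.* u ℤ.+ (a ℤ.* t ℤ.- m) ℤ.* v ≡ k
    vanish a b _ _ u v k refl refl = drop a b u v k

-- Windows of twelve consecutive non-holes

-- An offset together with the coordinates of its interpolation error in the chosen unknowns.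
Node : ℕ → Set
Node n = Vec ℤ n × ℕ

nodes : ∀ {n} → Vec ℕ n → List (Node n)
nodes []       = []
nodes (o ∷ os) = (1ℤ ∷ Vec.replicate _ 0ℤ , o) ∷ List.map (map₁ (0ℤ ∷_)) (nodes os)

-- The two lowest offsets, 0 and g, are the interpolation points, where the unknowns vanish.
nodesFrom : ∀ {n} → ℕ → Vec ℕ n → List (Node n)
nodesFrom g os = (Vec.replicate _ 0ℤ , 0) ∷ (Vec.replicate _ 0ℤ , g) ∷ nodes os

-- The equation forces x to lie above y, so w is the lowest and x the highest of four distinct
-- points. Fixing z < y lists each corner once.
Corners : (w x y z : ℕ) → Set
Corners w x y z = w < z × z < y × w + x ≡ y + z

corners? : ∀ w x y z → Dec (Corners w x y z)
corners? w x y z = w ℕ.<? z ×-dec z ℕ.<? y ×-dec w + x ℕ.≟ y + z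

difference : ∀ {n} (w x y z : Vec ℤ n) → Vec ℤ n
difference w x y z = combine 1ℤ -1ℤ (combine 1ℤ 1ℤ w x) (combine 1ℤ 1ℤ y z)

cornerRow : ∀ {n} (w y z x : Node n) → List (Vec ℤ n)
cornerRow (cw , w) (cy , y) (cz , z) (cx , x) with corners? w x y z
... | yes _ = difference cw cx cy cz ∷ []
... | no _  = []

-- `lowest` supplies the candidates for the lowest point of the corner: every node for the quadratic
-- system, only offset 0 for the linear one, which describes the corners through a new non-hole.
cornerRows : ∀ {n} (lowest others : List (Node n)) → List (Vec ℤ n)
cornerRows ws ns =
  concatMap (λ w → concatMap (λ y → concatMap (λ z → concatMap (cornerRow w y z) ns) ns) ns) ws

concatMap-All : {A B : Set} {P : Pred A 0ℓ} {Q : Pred B 0ℓ} {f : A → List B} →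
  (∀ {a} → P a → All Q (f a)) → ∀ {as} → All P as → All Q (concatMap f as)
concatMap-All g ps = All.concat⁺ (All.map⁺ (All.map g ps))

module _ {I : Set} (f : ℕ → I → ℤ) where

  nodes-sound : ∀ {n} (os : Vec ℕ n) →
    All (λ (c , o) → dot c (Vec.map f os) ≗ f o) (nodes os)
  nodes-sound []       = []
  nodes-sound (o ∷ os) =
    (λ i → trans (cong₂ ℤ._+_ (ℤ.*-identityˡ (f o i)) (dot-zero (Vec.map f os) i)) (ℤ.+-identityʳ _)) ∷
    All.map⁺ (All.map (λ {(c , p)} e i → trans (ℤ.+-identityˡ (dot c (Vec.map f os) i)) (e i)) (nodes-sound os))

  nodesFrom-sound : ∀ {n g} (os : Vec ℕ n) → f 0 ≗ (λ _ → 0ℤ) → f g ≗ (λ _ → 0ℤ) →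
    All (λ (c , o) → dot c (Vec.map f os) ≗ f o) (nodesFrom g os)
  nodesFrom-sound os f0 fg = (λ i → trans (dot-zero (Vec.map f os) i) (sym (f0 i)))
    ∷ (λ i → trans (dot-zero (Vec.map f os) i) (sym (fg i))) ∷ nodes-sound os

  module _ {n} {us : Vec (I → ℤ) n} {K R : Pred ℕ 0ℓ} where

    CornerRow : Pred (Vec ℤ n) 0ℓ
    CornerRow row = ∃[ w ] ∃[ x ] ∃[ y ] ∃[ z ] K w × R x × R y × R z × Corners w x y z ×
      (∀ i → dot row us i ≡ f w i ℤ.+ f x i ℤ.- (f y i ℤ.+ f z i))

    Represents : Pred ℕ 0ℓ → Pred (Node n) 0ℓ
    Represents S (c , o) = dot c us ≗ f o × S o

    dot-difference : ∀ cw cx cy cz i → dot (difference cw cx cy cz) us i ≡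
      dot cw us i ℤ.+ dot cx us i ℤ.- (dot cy us i ℤ.+ dot cz us i)
    dot-difference cw cx cy cz i = trans
      (dot-combine 1ℤ -1ℤ (combine 1ℤ 1ℤ cw cx) (combine 1ℤ 1ℤ cy cz) us i)
      (trans (cong₂ (λ s t → 1ℤ ℤ.* s ℤ.+ -1ℤ ℤ.* t)
          (dot-combine 1ℤ 1ℤ cw cx us i) (dot-combine 1ℤ 1ℤ cy cz us i))
        (lemma (dot cw us i) (dot cx us i) (dot cy us i) (dot cz us i)))
      where
      lemma : ∀ w x y z →
        1ℤ ℤ.* (1ℤ ℤ.* w ℤ.+ 1ℤ ℤ.* x) ℤ.+ -1ℤ ℤ.* (1ℤ ℤ.* y ℤ.+ 1ℤ ℤ.* z) ≡ w ℤ.+ x ℤ.- (y ℤ.+ z)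
      lemma = solve-∀

    cornerRow-sound : ∀ {w x y z} → Represents K w → Represents R y → Represents R z →
      Represents R x → All CornerRow (cornerRow w y z x)
    cornerRow-sound {cw , w} {cx , x} {cy , y} {cz , z} (ew , kw) (ey , ry) (ez , rz) (ex , rx)
      with corners? w x y z
    ... | no _  = []
    ... | yes q = (w , x , y , z , kw , rx , ry , rz , q , λ i → trans
      (dot-difference cw cx cy cz i)
      (cong₂ ℤ._-_ (cong₂ ℤ._+_ (ew i) (ex i)) (cong₂ ℤ._+_ (ey i) (ez i)))) ∷ []

    cornerRows-sound : ∀ {ws ns} → All (Represents K) ws → All (Represents R) ns →
      All CornerRow (cornerRows ws ns)
    cornerRows-sound kws rns =
      concatMap-All (λ w → concatMap-All (λ y → concatMap-All (λ z →
        concatMap-All (cornerRow-sound w y z) rns) rns) rns) kws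

-- The lists of n further offsets, in descending order (which keeps the elimination sparse),
-- where the first g positions from p on are known not to be holes.
windows : (n g p : ℕ) → List ℕ → List (List ℕ)
windows zero    g       p os = os ∷ []
windows (suc n) (suc g) p os = windows n g (suc p) (p ∷ os)
windows (suc n) zero    p os =
  windows n zero (suc p) (p ∷ os) ++ windows n 4 (2 + p) (suc p ∷ os)

-- The first component is the offset of the second non-hole. If it is 2, then 1 is a hole, and the
-- spacing keeps the four offsets 3 to 6 free of holes.
allWindows : List (ℕ × List ℕ)
allWindows = List.map (1 ,_) (windows 10 0 2 []) ++ List.map (2 ,_) (windows 10 4 3 [])

module _ (g : ℕ) (os : List ℕ) where

  windowNodes : List (Node (List.length os))
  windowNodes = nodesFrom g (Vec.fromList os)

  quadraticRows : List (Vec ℤ (triangle (List.length os)))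
  quadraticRows = List.map squareCoefficients (cornerRows windowNodes windowNodes)

  linearRows : List (Vec ℤ (List.length os))
  linearRows = cornerRows (List.take 1 windowNodes) windowNodes

  isDetermined : Bool
  isDetermined = hasFullRank linearRows ∧ hasFullRank quadraticRows

allDetermined : List (ℕ × List ℕ) → Bool
allDetermined []             = true
allDetermined ((g , os) ∷ ws) = isDetermined g os ∧ allDetermined ws

-- By evaluation: 26 windows start with a step of 1 and 8 with a step of 2, and each needs rank 10
-- for the linear and rank 55 for the quadratic system.
allWindows-determined : allDetermined allWindows ≡ true
allWindows-determined = refl

∧-true : ∀ {a b} → a ∧ b ≡ true → a ≡ true × b ≡ true
∧-true {true} {true} refl = refl , refl

determined : ∀ {g os} → (g , os) ∈ allWindows →
  hasFullRank (linearRows g os) ≡ true × hasFullRank (quadraticRows g os) ≡ true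
determined = go allWindows allWindows-determined
  where
  go : ∀ ws {g os} → allDetermined ws ≡ true → (g , os) ∈ ws →
    hasFullRank (linearRows g os) ≡ true × hasFullRank (quadraticRows g os) ≡ true
  go ((g , os) ∷ ws) all (here refl) = ∧-true (proj₁ (∧-true {isDetermined g os} all))
  go ((g , os) ∷ ws) all (there w∈)  = go ws (proj₂ (∧-true {isDetermined g os} all)) w∈

-- Enumeration of the non-holes and their windows

module NonHoles
  (hole : Pred ℕ 0ℓ) (hole? : Decidable hole)
  (spaced : ∀ {p q} → hole p → hole q → p < q → p + 6 ≤ q) where

  no-holes-near : ∀ {p} → hole p → ∀ j → j < 5 → ¬ hole (suc j + p)
  no-holes-near {p} hp j j<5 hq = ℕ.<⇒≱ (ℕ.+-monoˡ-< p (s≤s j<5))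
    (subst (_≤ suc j + p) (ℕ.+-comm p 6) (spaced hp hq (s≤s (ℕ.m≤n+m p j))))

  abstract
    -- Adjacent positions are never both holes, so skipping one position is enough.
    next : ℕ → ℕ
    next p with hole? (suc p)
    ... | yes _ = 2 + p
    ... | no _  = suc p

    nonHole-next : ∀ p → ¬ hole (next p)
    nonHole-next p with hole? (suc p)
    ... | yes h = no-holes-near h 0 (s≤s z≤n)
    ... | no ¬h = ¬h

    <next : ∀ p → p < next p
    <next p with hole? (suc p)
    ... | yes _ = s≤s (ℕ.n≤1+n p)
    ... | no _  = ℕ.n<1+n p

    next-unique : ∀ {p k} → p < k → k ≤ next p → ¬ hole k → k ≡ next p
    next-unique {p} {k} p<k k≤next ¬hk with hole? (suc p)
    ... | no _  = ℕ.≤-antisym k≤next p<k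
    ... | yes h with ℕ.m≤n⇒m<n∨m≡n p<k
    ...   | inj₁ 1+p<k = ℕ.≤-antisym k≤next 1+p<k
    ...   | inj₂ refl  = contradiction h ¬hk

    next-hole : ∀ p → hole (suc p) → next p ≡ 2 + p
    next-hole p h with hole? (suc p)
    ... | yes _ = refl
    ... | no ¬h = contradiction h ¬h

  abstract
    s : ℕ → ℕ
    s zero    = next 0
    s (suc k) = next (s k)

    s-zero : s 0 ≡ next 0
    s-zero = refl

    s-suc : ∀ k → s (suc k) ≡ next (s k)
    s-suc k = refl

  s<s-suc : ∀ k → s k < s (suc k)
  s<s-suc k = subst (s k <_) (sym (s-suc k)) (<next (s k))

  s-suc-unique : ∀ {k m} → s k < m → m ≤ s (suc k) → ¬ hole m → m ≡ s (suc k)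
  s-suc-unique {k} lt le ¬h = trans (next-unique lt (subst (_ ≤_) (s-suc k) le) ¬h) (sym (s-suc k))

  nonHole-s : ∀ k → ¬ hole (s k)
  nonHole-s zero    = subst (¬_ ∘ hole) (sym s-zero) (nonHole-next 0)
  nonHole-s (suc k) = subst (¬_ ∘ hole) (sym (s-suc k)) (nonHole-next (s k))

  s-positive : ∀ k → 0 < s k
  s-positive zero    = subst (0 <_) (sym s-zero) (<next 0)
  s-positive (suc k) = ℕ.≤-<-trans z≤n (s<s-suc k)

  s-mono-< : ∀ {i j} → i < j → s i < s j
  s-mono-< {i} {suc j} (s≤s i≤j) with ℕ.m≤n⇒m<n∨m≡n i≤j
  ... | inj₁ i<j  = ℕ.<-trans (s-mono-< i<j) (s<s-suc j)
  ... | inj₂ refl = s<s-suc j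

  s-mono-≤ : ∀ {i j} → i ≤ j → s i ≤ s j
  s-mono-≤ i≤j with ℕ.m≤n⇒m<n∨m≡n i≤j
  ... | inj₁ i<j  = ℕ.<⇒≤ (s-mono-< i<j)
  ... | inj₂ refl = ℕ.≤-refl

  s-cancel-< : ∀ {i j} → s i < s j → i < j
  s-cancel-< si<sj = ℕ.≰⇒> (λ j≤i → ℕ.<⇒≱ si<sj (s-mono-≤ j≤i))

  s-injective : ∀ {i j} → s i ≡ s j → i ≡ j
  s-injective e = ℕ.≤-antisym
    (ℕ.≮⇒≥ (λ j<i → ℕ.<⇒≢ (s-mono-< j<i) (sym e)))
    (ℕ.≮⇒≥ (λ i<j → ℕ.<⇒≢ (s-mono-< i<j) e))

  s-complete : ∀ {k} j → 0 < k → ¬ hole k → k ≤ s j → ∃[ i ] i ≤ j × k ≡ s i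
  s-complete zero    0<k ¬hk k≤ = zero , z≤n ,
    trans (next-unique 0<k (subst (_ ≤_) s-zero k≤) ¬hk) (sym s-zero)
  s-complete (suc j) 0<k ¬hk k≤ with ℕ.≤-<-connex _ (s j)
  ... | inj₁ k≤sj = let i , i≤j , k≡ = s-complete j 0<k ¬hk k≤sj in i , ℕ.m≤n⇒m≤1+n i≤j , k≡
  ... | inj₂ sj<k = suc j , ℕ.≤-refl , s-suc-unique sj<k k≤ ¬hk

  offsets : ℕ → ℕ → List ℕ
  offsets i zero    = []
  offsets i (suc n) = s (2 + n + i) ∸ s i ∷ offsets i n

  offset∈offsets : ∀ {i k n} → k < n → s (2 + k + i) ∸ s i ∈ offsets i n
  offset∈offsets {n = suc n} (s≤s k≤n) with ℕ.m≤n⇒m<n∨m≡n k≤n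
  ... | inj₁ k<n  = there (offset∈offsets k<n)
  ... | inj₂ refl = here refl

  offsets-All : ∀ {i} {R : Pred ℕ 0ℓ} n → (∀ k → k < n → R (s (2 + k + i) ∸ s i)) → All R (offsets i n)
  offsets-All zero    r = []
  offsets-All (suc n) r = r n ℕ.≤-refl ∷ offsets-All n (λ k k<n → r k (ℕ.m≤n⇒m≤1+n k<n))

  offset≡ : ∀ {i j o} → s i + o ≡ s j → s j ∸ s i ≡ o
  offset≡ {i} {o = o} e = trans (cong (_∸ s i) (sym e)) (ℕ.m+n∸m≡n (s i) o)

  s-suc-nonHole : ∀ k → ¬ hole (suc (s k)) → s (suc k) ≡ suc (s k)
  s-suc-nonHole k ¬h = sym (s-suc-unique ℕ.≤-refl (s<s-suc k) ¬h)

  s-suc-hole : ∀ k → hole (suc (s k)) → s (suc k) ≡ 2 + s k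
  s-suc-hole k h = trans (s-suc k) (next-hole (s k) h)

  mutual
    -- Follows the recursion of `windows`. The invariant is that `p` is the offset just after the
    -- last recorded non-hole and that the `g` positions from there on are free of holes.
    offsets∈windows : ∀ {i} n k g p → s i + p ≡ suc (s (1 + k + i)) →
      (∀ j → j < g → ¬ hole (j + suc (s (1 + k + i)))) →
      offsets i (n + k) ∈ windows n g p (offsets i k)
    offsets∈windows zero k g p e gap = here refl
    offsets∈windows {i} (suc n) k (suc g) p e gap = pushOffset n k g p (trans e (sym step))
      λ j j<g → subst (¬_ ∘ hole) (trans (sym (ℕ.+-suc j _)) (cong (λ t → j + suc t) (sym step)))
        (gap (suc j) (s≤s j<g))
      where
      step = s-suc-nonHole (1 + k + i) (gap 0 (s≤s z≤n))
    offsets∈windows {i} (suc n) k zero p e gap with hole? (suc (s (1 + k + i)))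
    ... | no ¬h = ∈.∈-++⁺ˡ (pushOffset n k 0 p (trans e (sym (s-suc-nonHole _ ¬h))) (λ _ ()))
    ... | yes h = ∈.∈-++⁺ʳ (windows n 0 (suc p) (p ∷ offsets i k)) (pushOffset n k 4 (suc p)
      (trans (ℕ.+-suc (s i) p) (trans (cong suc e) (sym step)))
      λ j j<4 → subst (¬_ ∘ hole) (trans (shift j _) (cong (λ t → j + suc t) (sym step)))
        (no-holes-near h (suc j) (s≤s j<4)))
      where
      step = s-suc-hole (1 + k + i) h
      shift : ∀ j a → 2 + j + (1 + a) ≡ j + (3 + a)
      shift = ℕ-Solver.solve-∀

    pushOffset : ∀ {i} n k g p → s i + p ≡ s (2 + k + i) →
      (∀ j → j < g → ¬ hole (j + suc (s (2 + k + i)))) →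
      offsets i (suc n + k) ∈ windows n g (suc p) (p ∷ offsets i k)
    pushOffset {i} n k g p e gap =
      subst₂ (λ l o → offsets i l ∈ windows n g (suc p) (o ∷ offsets i k)) (ℕ.+-suc n k) (offset≡ e)
        (offsets∈windows n (suc k) g (suc p) (trans (ℕ.+-suc (s i) p) (cong suc e)) gap)

  offsets∈allWindows : ∀ i → (s (suc i) ∸ s i , offsets i 10) ∈ allWindows
  offsets∈allWindows i with hole? (suc (s i))
  ... | no ¬h = ∈.∈-++⁺ˡ (subst (λ g → (g , offsets i 10) ∈ List.map (1 ,_) (windows 10 0 2 []))
      (sym (offset≡ (trans (ℕ.+-comm (s i) 1) (sym step))))
      (∈.∈-map⁺ (1 ,_) (offsets∈windows 10 0 0 2 (trans (ℕ.+-comm (s i) 2) (cong suc (sym step))) (λ _ ()))))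
    where
    step = s-suc-nonHole i ¬h
  ... | yes h = ∈.∈-++⁺ʳ (List.map (1 ,_) (windows 10 0 2 []))
    (subst (λ g → (g , offsets i 10) ∈ List.map (2 ,_) (windows 10 4 3 []))
      (sym (offset≡ (trans (ℕ.+-comm (s i) 2) (sym step))))
      (∈.∈-map⁺ (2 ,_) (offsets∈windows 10 0 4 3 (trans (ℕ.+-comm (s i) 3) (cong suc (sym step)))
        λ j j<4 → subst (¬_ ∘ hole) (trans (shift j _) (cong (λ t → j + suc t) (sym step)))
          (no-holes-near h (suc j) (s≤s j<4)))))
    where
    step = s-suc-hole i h
    shift : ∀ j a → 2 + j + (1 + a) ≡ j + (3 + a)
    shift = ℕ-Solver.solve-∀

  abstract
    windowOffsets : ℕ → List ℕ
    windowOffsets i = offsets i 10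

    offset∈windowOffsets : ∀ {i k} → k < 10 → s (2 + k + i) ∸ s i ∈ windowOffsets i
    offset∈windowOffsets {i} = offset∈offsets {i}

    windowOffsets-All : ∀ {i} {R : Pred ℕ 0ℓ} → (∀ k → k < 10 → R (s (2 + k + i) ∸ s i)) →
      All R (windowOffsets i)
    windowOffsets-All {i} r = offsets-All {i} 10 r

    window∈ : ∀ i → (s (suc i) ∸ s i , windowOffsets i) ∈ allWindows
    window∈ = offsets∈allWindows

-- Corners in terms of interpolation errors

-- (1 , w) is kept in front: in the induction step w is the new, lowest position.
upper : (x y z : ℕ) → Combination
upper x y z = (1ℤ , x) ∷ (-1ℤ , y) ∷ (-1ℤ , z) ∷ []

corner : (w x y z : ℕ) → Combination
corner w x y z = (1ℤ , w) ∷ upper x y z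

cast-+ : ∀ {w x y z} → w + x ≡ y + z → + w ℤ.+ + x ≡ + y ℤ.+ + z
cast-+ {w} {x} {y} {z} e = trans (sym (ℤ.pos-+ w x)) (trans (cong +_ e) (ℤ.pos-+ y z))

interpolationError-left : ∀ a b i → ⟦ interpolationError a b a ⟧ i ≡ 0ℤ
interpolationError-left a b i = lemma (+ a) (+ b) (δ a i) (δ b i)
  where
  lemma : ∀ a b u v → (b ℤ.- a) ℤ.* u ℤ.+ ((a ℤ.- b) ℤ.* u ℤ.+ ((a ℤ.- a) ℤ.* v ℤ.+ 0ℤ)) ≡ 0ℤ
  lemma = solve-∀

interpolationError-right : ∀ a b i → ⟦ interpolationError a b b ⟧ i ≡ 0ℤ
interpolationError-right a b i = lemma (+ a) (+ b) (δ a i) (δ b i)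
  where
  lemma : ∀ a b u v → (b ℤ.- a) ℤ.* v ℤ.+ ((b ℤ.- b) ℤ.* u ℤ.+ ((a ℤ.- b) ℤ.* v ℤ.+ 0ℤ)) ≡ 0ℤ
  lemma = solve-∀

-- The two sides differ by (w + x - y - z)(δ_a - δ_b): interpolation is affine, so a combination
-- with vanishing moments does not see it.
interpolationError-corner : ∀ {a b w x y z} → w + x ≡ y + z → ∀ i →
  (+ b ℤ.- + a) ℤ.* ⟦ corner w x y z ⟧ i ≡
  ⟦ interpolationError a b w ⟧ i ℤ.+ ⟦ interpolationError a b x ⟧ i
    ℤ.- (⟦ interpolationError a b y ⟧ i ℤ.+ ⟦ interpolationError a b z ⟧ i)
interpolationError-corner {a} {b} {w} {x} {y} {z} e i = begin
  (+ b ℤ.- + a) ℤ.* ⟦ corner w x y z ⟧ i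
    ≡⟨ lemma₀ (+ a) (+ b) (δ a i) (δ b i) (δ w i) (δ x i) (δ y i) (δ z i) (+ y ℤ.+ + z) ⟩
  lhs ((+ y ℤ.+ + z) ℤ.- (+ y ℤ.+ + z))
    ≡⟨ cong (λ t → lhs (t ℤ.- (+ y ℤ.+ + z))) (cast-+ {w} {x} {y} {z} e) ⟨
  lhs ((+ w ℤ.+ + x) ℤ.- (+ y ℤ.+ + z))
    ≡⟨ lemma₁ (+ a) (+ b) (+ w) (+ x) (+ y) (+ z) (δ a i) (δ b i) (δ w i) (δ x i) (δ y i) (δ z i) ⟩
  _ ∎
  where
  open ≡-Reasoning
  lhs : ℤ → ℤ
  lhs t = (+ b ℤ.- + a) ℤ.* (δ w i ℤ.+ δ x i ℤ.- δ y i ℤ.- δ z i) ℤ.+ t ℤ.* (δ a i ℤ.- δ b i)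
  lemma₀ : ∀ a b u v w′ x′ y′ z′ t →
    (b ℤ.- a) ℤ.* (1ℤ ℤ.* w′ ℤ.+ (1ℤ ℤ.* x′ ℤ.+ (-1ℤ ℤ.* y′ ℤ.+ (-1ℤ ℤ.* z′ ℤ.+ 0ℤ)))) ≡
    (b ℤ.- a) ℤ.* (w′ ℤ.+ x′ ℤ.- y′ ℤ.- z′) ℤ.+ (t ℤ.- t) ℤ.* (u ℤ.- v)
  lemma₀ = solve-∀
  lemma₁ : ∀ a b w x y z u v w′ x′ y′ z′ →
    (b ℤ.- a) ℤ.* (w′ ℤ.+ x′ ℤ.- y′ ℤ.- z′) ℤ.+ (w ℤ.+ x ℤ.- (y ℤ.+ z)) ℤ.* (u ℤ.- v) ≡
    ((b ℤ.- a) ℤ.* w′ ℤ.+ ((w ℤ.- b) ℤ.* u ℤ.+ ((a ℤ.- w) ℤ.* v ℤ.+ 0ℤ))) ℤ.+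
    ((b ℤ.- a) ℤ.* x′ ℤ.+ ((x ℤ.- b) ℤ.* u ℤ.+ ((a ℤ.- x) ℤ.* v ℤ.+ 0ℤ))) ℤ.-
    (((b ℤ.- a) ℤ.* y′ ℤ.+ ((y ℤ.- b) ℤ.* u ℤ.+ ((a ℤ.- y) ℤ.* v ℤ.+ 0ℤ))) ℤ.+
     ((b ℤ.- a) ℤ.* z′ ℤ.+ ((z ℤ.- b) ℤ.* u ℤ.+ ((a ℤ.- z) ℤ.* v ℤ.+ 0ℤ))))
  lemma₁ = solve-∀

nodes-All : {S : Pred ℕ 0ℓ} {os : List ℕ} → All S os → All (S ∘ proj₂) (nodes (Vec.fromList os))
nodes-All []       = []
nodes-All (p ∷ ps) = p ∷ All.map⁺ (nodes-All ps)

-- Downward induction on the lowest non-hole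

module Core
  (hole : Pred ℕ 0ℓ) (hole? : Decidable hole)
  (spaced : ∀ {p q} → hole p → hole q → p < q → p + 6 ≤ q)
  (N : ℕ)
  where

  open NonHoles hole hole? spaced

  -- The possible distances from a non-hole to the next two. The pair 2, 4 would need two holes at
  -- distance 2.
  data Steps : ℕ → ℕ → Set where
    1-2 : Steps 1 2
    1-3 : Steps 1 3
    2-3 : Steps 2 3

  steps : ∀ k → ∃₂ λ a b → Steps a b × s (1 + k) ≡ a + s k × s (2 + k) ≡ b + s k
  steps k with hole? (suc (s k)) | hole? (suc (s (suc k)))
  ... | no ¬h | no ¬h′ = 1 , 2 , 1-2 , s-suc-nonHole k ¬h ,
    trans (s-suc-nonHole (suc k) ¬h′) (cong suc (s-suc-nonHole k ¬h))
  ... | no ¬h | yes h′ = 1 , 3 , 1-3 , s-suc-nonHole k ¬h ,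
    trans (s-suc-hole (suc k) h′) (cong (2 ℕ.+_) (s-suc-nonHole k ¬h))
  ... | yes h | no ¬h′ = 2 , 3 , 2-3 , s-suc-hole k h ,
    trans (s-suc-nonHole (suc k) ¬h′) (cong suc (s-suc-hole k h))
  ... | yes h | yes h′ = contradiction (subst (hole ∘ suc) (s-suc-hole k h) h′)
    (no-holes-near h 1 (s≤s (s≤s z≤n)))

  -- Two 2-element subsets of {1, 2, 3} intersect.
  common : ∀ {a b c d} → Steps a b → Steps c d →
    (d ≡ a ⊎ d ≡ b) ⊎ (d ≡ c + a ⊎ d ≡ c + b)
  common 1-2 1-2 = inj₂ (inj₁ refl)
  common 1-2 1-3 = inj₂ (inj₂ refl)
  common 1-2 2-3 = inj₂ (inj₁ refl)
  common 1-3 1-2 = inj₂ (inj₁ refl)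
  common 1-3 1-3 = inj₁ (inj₂ refl)
  common 1-3 2-3 = inj₁ (inj₂ refl)
  common 2-3 1-2 = inj₁ (inj₁ refl)
  common 2-3 1-3 = inj₁ (inj₂ refl)
  common 2-3 2-3 = inj₁ (inj₂ refl)

  far-sum : ∀ {x y p q} a → p ≡ a + y → q ≡ a + x → x + p ≡ y + q
  far-sum {x} {y} a refl refl = lemma x a y
    where
    lemma : ∀ x a y → x + (a + y) ≡ y + (a + x)
    lemma = ℕ-Solver.solve-∀

  near-sum : ∀ {x y p q r} c a → p ≡ c + a + y → r ≡ c + y → q ≡ a + x → x + p ≡ r + q
  near-sum {x} {y} c a refl refl refl = lemma x c a y
    where
    lemma : ∀ x c a y → x + (c + a + y) ≡ (c + y) + (a + x)
    lemma = ℕ-Solver.solve-∀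

  -- The distances from `s i` up to the next two non-holes and from `s (2 + l)` down to the previous
  -- two are 2-element subsets of {1, 2, 3}. Moving both points inwards by a shared distance
  -- preserves their sum. The downward distances are d and d - c, which `common` expresses without
  -- subtraction.
  parallelogram : ∀ i l → ∃₂ λ k j → (k ≡ l ⊎ k ≡ suc l) × (j ≡ 1 + i ⊎ j ≡ 2 + i) ×
    s i + s (2 + l) ≡ s k + s j
  parallelogram i l with steps i | steps l
  ... | a , b , st , ea , eb | c , d , st′ , ec , ed with common st st′
  ...   | inj₁ (inj₁ refl) = l , 1 + i , inj₁ refl , inj₁ refl , far-sum a ed ea
  ...   | inj₁ (inj₂ refl) = l , 2 + i , inj₁ refl , inj₂ refl , far-sum b ed eb
  ...   | inj₂ (inj₁ refl) = suc l , 1 + i , inj₂ refl , inj₁ refl , near-sum c a ed ec ea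
  ...   | inj₂ (inj₂ refl) = suc l , 2 + i , inj₂ refl , inj₂ refl , near-sum c b ed ec eb

  NonHoleFrom : ℕ → Pred ℕ 0ℓ
  NonHoleFrom i p = ∃[ j ] i ≤ j × j < N × p ≡ s j

  raise : ∀ {i p} → NonHoleFrom i p → s i < p → NonHoleFrom (suc i) p
  raise (j , _ , j<N , refl) si<p = j , s-cancel-< si<p , j<N , refl

  lower : ∀ {i p} → NonHoleFrom (suc i) p → NonHoleFrom i p
  lower (j , i<j , rest) = j , ℕ.<⇒≤ i<j , rest

  record Relation (i : ℕ) (cs : Combination) : Set where
    constructor relation
    field
      support  : All (NonHoleFrom i ∘ proj₂) cs
      total≡0  : total cs ≡ 0ℤ
      moment≡0 : moment cs ≡ 0ℤ
  open Relation

  error : ℕ → ℕ → ℕ → ℤ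
  error i o = ⟦ interpolationError (s i) (s (suc i)) (s i + o) ⟧

  module _ {i} (12+i≤N : 12 + i ≤ N) where

    private
      g = s (suc i) ∸ s i
      os = windowOffsets i

      s+∸ : ∀ {j} → i ≤ j → s i + (s j ∸ s i) ≡ s j
      s+∸ i≤j = ℕ.m+[n∸m]≡n (s-mono-≤ i≤j)

      12+k≤ : ∀ {k} → k < 12 → NonHoleFrom i (s (k + i))
      12+k≤ {k} k<12 = k + i , ℕ.m≤n+m i k , ℕ.<-≤-trans (ℕ.+-monoˡ-< i k<12) 12+i≤N , refl

    error-0 : ∀ t → error i 0 t ≡ 0ℤ
    error-0 t rewrite ℕ.+-identityʳ (s i) = interpolationError-left (s i) (s (suc i)) t

    error-g : ∀ t → error i g t ≡ 0ℤ
    error-g t rewrite s+∸ (ℕ.n≤1+n i) = interpolationError-right (s i) (s (suc i)) t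

    windowNodes-sound : All (λ (c , o) →
      (dot c (Vec.map (error i) (Vec.fromList os)) ≗ error i o) × NonHoleFrom i (s i + o)) (windowNodes g os)
    windowNodes-sound = All.zip (nodesFrom-sound (error i) {g = g} (Vec.fromList os) error-0 error-g ,
      subst (NonHoleFrom i) (sym (ℕ.+-identityʳ (s i))) (12+k≤ {0} (s≤s z≤n)) ∷
      subst (NonHoleFrom i) (sym (s+∸ (ℕ.n≤1+n i))) (12+k≤ {1} (s≤s (s≤s z≤n))) ∷
      nodes-All (windowOffsets-All (λ k k<10 →
        subst (NonHoleFrom i) (sym (s+∸ (ℕ.m≤n+m i (2 + k)))) (12+k≤ (s≤s (s≤s k<10))))))

    window⇒ : ∀ {Q} → PureSubgroup Q → (∀ {o} → o ∈ os → Q (error i o)) →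
      ∀ k → k < 12 → Q ⟦ interpolationError (s i) (s (suc i)) (s (k + i)) ⟧
    window⇒ Q-pure qs zero _ =
      respects Q-pure (λ t → sym (interpolationError-left (s i) (s (suc i)) t)) (zero∈ Q-pure)
    window⇒ Q-pure qs (suc zero) _ =
      respects Q-pure (λ t → sym (interpolationError-right (s i) (s (suc i)) t)) (zero∈ Q-pure)
    window⇒ {Q} Q-pure qs (suc (suc k)) (s≤s (s≤s k<10)) =
      subst (λ p → Q ⟦ interpolationError (s i) (s (suc i)) p ⟧) (s+∸ (ℕ.m≤n+m i (2 + k)))
        (qs (offset∈windowOffsets k<10))

    shift-Corners : ∀ {w x y z} → Corners w x y z → Corners (s i + w) (s i + x) (s i + y) (s i + z)
    shift-Corners {w} {x} {y} {z} (w<z , z<y , e) =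
      ℕ.+-monoʳ-< (s i) w<z , ℕ.+-monoʳ-< (s i) z<y ,
      trans (rearrange (s i) w x) (trans (cong (s i + s i ℕ.+_) e) (sym (rearrange (s i) y z)))
      where
      rearrange : ∀ m w x → (m + w) + (m + x) ≡ (m + m) + (w + x)
      rearrange = ℕ-Solver.solve-∀

    cornerRow-corner : ∀ {w x y z} → Corners w x y z → ∀ t →
      error i w t ℤ.+ error i x t ℤ.- (error i y t ℤ.+ error i z t) ≡
      (+ s (suc i) ℤ.- + s i) ℤ.* ⟦ corner (s i + w) (s i + x) (s i + y) (s i + z) ⟧ t
    cornerRow-corner {w} {x} {y} {z} c t = sym (interpolationError-corner
      {s i} {s (suc i)} {s i + w} {s i + x} {s i + y} {s i + z} (proj₂ (proj₂ (shift-Corners c))) t)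

    -- The verified rank of `linearRows`: the corners through the lowest point of a window already
    -- generate, up to purity, all relations on the window.
    linear⇒ : ∀ {Q} → PureSubgroup Q →
      (∀ {x y z} → NonHoleFrom i x → NonHoleFrom i y → NonHoleFrom i z → Corners (s i) x y z →
        Q ⟦ corner (s i) x y z ⟧) →
      ∀ k → k < 12 → Q ⟦ interpolationError (s i) (s (suc i)) (s (k + i)) ⟧
    linear⇒ {Q} Q-pure q = window⇒ Q-pure (λ o∈ → lookup os all∈ o∈)
      where
      rows∈ : All (λ row → Q (dot row (Vec.map (error i) (Vec.fromList os)))) (linearRows g os)
      rows∈ = All.map (λ { {row} (w , x , y , z , w≡0 , hx , hy , hz , c , e) →
          respects Q-pure (λ t → sym (trans (e t) (cornerRow-corner c t)))
            (scaled Q-pure (+ s (suc i) ℤ.- + s i)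
              (corner∈ w≡0 hx hy hz (shift-Corners c))) })
        (cornerRows-sound (error i) {K = λ w → s i + w ≡ s i} {R = λ o → NonHoleFrom i (s i + o)}
          ((proj₁ (All.head windowNodes-sound) , ℕ.+-identityʳ (s i)) ∷ []) windowNodes-sound)
        where
        corner∈ : ∀ {w x y z} → w ≡ s i → NonHoleFrom i x → NonHoleFrom i y → NonHoleFrom i z →
          Corners w x y z → Q ⟦ corner w x y z ⟧
        corner∈ refl = q
      all∈ = fullRank⇒all∈ Q-pure (linearRows g os) (Vec.map (error i) (Vec.fromList os))
        (proj₁ (determined (window∈ i))) rows∈
      lookup : ∀ (as : List ℕ) → VecAll.All Q (Vec.map (error i) (Vec.fromList as)) →
        ∀ {a} → a ∈ as → Q (error i a)
      lookup (_ ∷ as) (p ∷ _)  (here refl) = p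
      lookup (_ ∷ as) (_ ∷ ps) (there a∈)  = lookup as ps a∈

  module _ {P : Pred (ℕ × ℕ → ℤ) 0ℓ} (P-pure : PureSubgroup P)
    (corner∈ : ∀ {w x y z} → NonHoleFrom 0 w → NonHoleFrom 0 x → NonHoleFrom 0 y → NonHoleFrom 0 z →
      Corners w x y z → P (⟦ corner w x y z ⟧ ⊙ ⟦ corner w x y z ⟧)) where

    -- Named after the view modulo `P`: the symmetric product is zero on the lattice vectors
    -- supported from the i-th non-hole on.
    Vanishing : ℕ → Set
    Vanishing i = ∀ {cs ds} → Relation i cs → Relation i ds → P (⟦ cs ⟧ ⊙ ⟦ ds ⟧)

    ⊙-swap : ∀ {x y} → P (x ⊙ y) → P (y ⊙ x)
    ⊙-swap {x} {y} = respects P-pure (⊙-comm x y)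

    ⊙-pureˡ : ∀ y → PureSubgroup (λ x → P (x ⊙ y))
    ⊙-pureˡ y = record
      { respects = λ {f} {g} e f∈ → ⊙-swap {y} {g} (respects (⊙-pure P-pure y) e (⊙-swap {f} {y} f∈))
      ; zero∈    = ⊙-swap {y} {λ _ → 0ℤ} (zero∈ (⊙-pure P-pure y))
      ; linear   = λ α β {f} {g} f∈ g∈ → ⊙-swap {y} (linear (⊙-pure P-pure y) α β (⊙-swap {f} {y} f∈) (⊙-swap {g} {y} g∈))
      ; pure     = λ {_} {f} α≢0 αf∈ → ⊙-swap {y} {f} (pure (⊙-pure P-pure y) α≢0 (⊙-swap {_} {y} αf∈))
      }

    weaken : ∀ {i p} → NonHoleFrom i p → NonHoleFrom 0 p
    weaken (j , _ , rest) = j , z≤n , rest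

    relation⇒ : ∀ {i Q} → PureSubgroup Q → ∀ {a b} → a < b →
      (∀ {j} → i ≤ j → j < N → Q ⟦ interpolationError a b (s j) ⟧) →
      ∀ {cs} → Relation i cs → Q ⟦ cs ⟧
    relation⇒ Q-pure a<b qs {cs} r = relation∈ Q-pure (ℕ.<⇒≢ a<b) cs
      (All.map (λ { (j , i≤j , j<N , refl) → qs i≤j j<N }) (support r)) (total≡0 r) (moment≡0 r)

    base : ∀ i → 12 + i ≡ N → Vanishing i
    -- By bilinearity each factor in turn is replaced by interpolation errors, which leaves the
    -- products of two unknowns that the quadratic system determines.
    base i refl {cs} {ds} rcs rds = relation⇒ (⊙-pureˡ ⟦ ds ⟧) (s<s-suc i)
      (λ {j} i≤j j<N → at i≤j j<N (⊙-pureˡ ⟦ ds ⟧) λ {o} o∈ →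
        relation⇒ (⊙-pure P-pure (error i o)) (s<s-suc i) (λ i≤j′ j′<N →
          at i≤j′ j′<N (⊙-pure P-pure (error i o)) λ o′∈ → errors∈ o∈ o′∈) rds) rcs
      where
      g = s (suc i) ∸ s i
      os = windowOffsets i
      at : ∀ {j} → i ≤ j → j < 12 + i → ∀ {Q} → PureSubgroup Q →
        (∀ {o} → o ∈ os → Q (error i o)) → Q ⟦ interpolationError (s i) (s (suc i)) (s j) ⟧
      at {j} i≤j j<N {Q} Q-pure qs = subst (λ k → Q ⟦ interpolationError (s i) (s (suc i)) (s k) ⟧)
        (ℕ.m∸n+n≡m i≤j) (window⇒ ℕ.≤-refl Q-pure qs (j ∸ i)
          (ℕ.+-cancelʳ-< i (j ∸ i) 12 (subst (_< 12 + i) (sym (ℕ.m∸n+n≡m i≤j)) j<N)))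
      us = Vec.map (error i) (Vec.fromList os)
      rows∈ : All (λ row → P (dot row (products us))) (quadraticRows g os)
      rows∈ = All.map⁺ (All.map (λ { {row} (w , x , y , z , hw , hx , hy , hz , c , e) →
          let v = ⟦ corner (s i + w) (s i + x) (s i + y) (s i + z) ⟧
              α = + s (suc i) ℤ.- + s i
              eq = λ t → trans (e t) (cornerRow-corner ℕ.≤-refl c t)
              v∈ = corner∈ (weaken hw) (weaken hx) (weaken hy) (weaken hz) (shift-Corners ℕ.≤-refl c)
          -- The row represents `α` times the corner `v`, so its square is `v ⊙ v` scaled once by
          -- `α` in each factor.
          in respects P-pure (λ t → sym (trans (dot-square row us t) (⊙-cong eq eq t)))
            (scaled (⊙-pure P-pure (λ t → α ℤ.* v t)) α {v} (scaled (⊙-pureˡ v) α {v} v∈)) })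
        (cornerRows-sound (error i) {K = λ o → NonHoleFrom i (s i + o)} {R = λ o → NonHoleFrom i (s i + o)}
          (windowNodes-sound ℕ.≤-refl) (windowNodes-sound ℕ.≤-refl)))
      errors∈ : ∀ {o o′} → o ∈ os → o′ ∈ os → P (error i o ⊙ error i o′)
      errors∈ = products∈ P-pure (error i) os
        (fullRank⇒all∈ P-pure (quadraticRows g os) (products us) (proj₂ (determined (window∈ i))) rows∈)

    -- The polarisation identity 2 u ⊙ v = u ⊙ u + v ⊙ v − (v − u) ⊙ (v − u).
    polarise : ∀ {u v d} → (∀ t → d t ≡ v t ℤ.- u t) →
      P (u ⊙ u) → P (v ⊙ v) → P (d ⊙ d) → P (u ⊙ v)
    polarise {u} {v} {d} d≡ u∈ v∈ d∈ = pure P-pure {+ 2} {u ⊙ v} (λ ())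
      (respects P-pure (λ (t , t′) → trans
        (cong₂ (λ a b → 1ℤ ℤ.* (1ℤ ℤ.* (u t ℤ.* u t′ ℤ.+ u t ℤ.* u t′) ℤ.+ 1ℤ ℤ.* (v t ℤ.* v t′ ℤ.+ v t ℤ.* v t′))
          ℤ.+ -1ℤ ℤ.* (a ℤ.* b ℤ.+ a ℤ.* b)) (d≡ t) (d≡ t′))
        (identity (u t) (u t′) (v t) (v t′)))
        (linear P-pure 1ℤ -1ℤ (linear P-pure 1ℤ 1ℤ u∈ v∈) d∈))
      where
      identity : ∀ u u′ v v′ →
        1ℤ ℤ.* (1ℤ ℤ.* (u ℤ.* u′ ℤ.+ u ℤ.* u′) ℤ.+ 1ℤ ℤ.* (v ℤ.* v′ ℤ.+ v ℤ.* v′)) ℤ.+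
          -1ℤ ℤ.* ((v ℤ.- u) ℤ.* (v′ ℤ.- u′) ℤ.+ (v ℤ.- u) ℤ.* (v′ ℤ.- u′)) ≡
        + 2 ℤ.* (u ℤ.* v′ ℤ.+ v ℤ.* u′)
      identity = solve-∀

    module Step (i : ℕ) (12+i<N : 12 + i < N) (vanishing : Vanishing (suc i)) where

      private
        a b : ℕ
        a = s (suc i)
        b = s (2 + i)

        12+i≤N : 12 + i ≤ N
        12+i≤N = ℕ.<⇒≤ 12+i<N

      record Lowest (x y z : ℕ) : Set where
        constructor lowest
        field
          x∈ : NonHoleFrom i x
          y∈ : NonHoleFrom i y
          z∈ : NonHoleFrom i z
          corners : Corners (s i) x y z

      bottom∈ : NonHoleFrom i (s i)
      bottom∈ = i , ℕ.≤-refl , ℕ.<-≤-trans (ℕ.m<n+m i (s≤s z≤n)) 12+i≤N , refl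

      lowest-square : ∀ {x y z} → Lowest x y z → P (⟦ corner (s i) x y z ⟧ ⊙ ⟦ corner (s i) x y z ⟧)
      lowest-square (lowest x∈ y∈ z∈ c) = corner∈ (weaken bottom∈) (weaken x∈) (weaken y∈) (weaken z∈) c

      upper∈ : ∀ {x y z} → Lowest x y z → All (NonHoleFrom (suc i) ∘ proj₂) (upper x y z)
      upper∈ {x} {y} {z} (lowest x∈ y∈ z∈ (w<z , z<y , e)) =
        raise x∈ (ℕ.<-trans w<y (ℕ.≰⇒> λ x≤y → ℕ.<⇒≢ (ℕ.+-mono-<-≤ w<z x≤y) (trans e (ℕ.+-comm y z)))) ∷
        raise y∈ w<y ∷ raise z∈ w<z ∷ []
        where
        w<y = ℕ.<-trans w<z z<y

      upper-moment : ∀ {x y z} → Lowest x y z → moment (upper x y z) ≡ ℤ.- + s i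
      upper-moment {x} {y} {z} c = trans (isolate (+ s i) (+ x) (+ y) (+ z))
        (trans (cong (λ t → t ℤ.- (+ y ℤ.+ + z) ℤ.- + s i) (cast-+ {s i} {x} {y} {z} (proj₂ (proj₂ (Lowest.corners c)))))
          (cancel (+ y ℤ.+ + z) (+ s i)))
        where
        isolate : ∀ w x y z → 1ℤ ℤ.* x ℤ.+ (-1ℤ ℤ.* y ℤ.+ (-1ℤ ℤ.* z ℤ.+ 0ℤ)) ≡ w ℤ.+ x ℤ.- (y ℤ.+ z) ℤ.- w
        isolate = solve-∀
        cancel : ∀ t w → t ℤ.- t ℤ.- w ≡ ℤ.- w
        cancel = solve-∀

      -- The bound 3 + i ≤ l puts both candidates for the lower inner point, with indices 1 + i and
      -- 2 + i, strictly below both candidates for the upper one.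
      farCorner : ∀ l → 3 + i ≤ l → 2 + l < N → ∃₂ λ k j →
        (k ≡ l ⊎ k ≡ suc l) × (j ≡ 1 + i ⊎ j ≡ 2 + i) × Lowest (s (2 + l)) (s k) (s j)
      farCorner l 3+i≤l 2+l<N =
        let k , j , k≡ , j≡ , e = parallelogram i l
            i<j = above j≡
            j<k = ℕ.<-≤-trans (ℕ.<-≤-trans (below j≡) 3+i≤l) (far k≡)
            k<N = ℕ.≤-<-trans (near k≡) 2+l<N
        in k , j , k≡ , j≡ , lowest
          (2 + l , ℕ.≤-trans (ℕ.<⇒≤ i<j) (ℕ.≤-trans (ℕ.<⇒≤ j<k) (near k≡)) , 2+l<N , refl)
          (k , ℕ.<⇒≤ (ℕ.<-trans i<j j<k) , k<N , refl)
          (j , ℕ.<⇒≤ i<j , ℕ.<-trans j<k k<N , refl)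
          (s-mono-< i<j , s-mono-< j<k , e)
        where
        above : ∀ {j} → j ≡ 1 + i ⊎ j ≡ 2 + i → i < j
        above (inj₁ refl) = ℕ.≤-refl
        above (inj₂ refl) = ℕ.n≤1+n _
        below : ∀ {j} → j ≡ 1 + i ⊎ j ≡ 2 + i → j < 3 + i
        below (inj₁ refl) = ℕ.n≤1+n _
        below (inj₂ refl) = ℕ.≤-refl
        far : ∀ {k} → k ≡ l ⊎ k ≡ suc l → l ≤ k
        far (inj₁ refl) = ℕ.≤-refl
        far (inj₂ refl) = ℕ.n≤1+n _
        near : ∀ {k} → k ≡ l ⊎ k ≡ suc l → k ≤ 2 + l
        near (inj₁ refl) = ℕ.≤-trans (ℕ.n≤1+n _) (ℕ.n≤1+n _)
        near (inj₂ refl) = ℕ.n≤1+n _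

      private
        -- Any corner through `s i` would serve as v₀. With l = 9 + i its top is `s (11 + i)`, the
        -- last point of the window.
        reference = farCorner (9 + i) (ℕ.+-monoˡ-≤ i (s≤s (s≤s (s≤s (z≤n {6})))))
          (ℕ.<-≤-trans (ℕ.+-monoˡ-< i (ℕ.≤-refl {12})) 12+i≤N)
        x₀ = s (11 + i)
        y₀ = s (proj₁ reference)
        z₀ = s (proj₁ (proj₂ reference))
        lowest₀ : Lowest x₀ y₀ z₀
        lowest₀ = proj₂ (proj₂ (proj₂ (proj₂ reference)))

        v₀ = ⟦ corner (s i) x₀ y₀ z₀ ⟧

        v₀⊙-pure = ⊙-pure P-pure v₀

      -- Both corners have coefficient 1 at `s i`, and without that point both have first moment
      -- -`s i`. Their difference is therefore a relation on the higher non-holes, where `vanishing`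
      -- supplies the third square needed for polarisation.
      v₀⊙lowest : ∀ {x y z} → Lowest x y z → P (v₀ ⊙ ⟦ corner (s i) x y z ⟧)
      v₀⊙lowest {x} {y} {z} c = polarise {v₀} {⟦ corner (s i) x y z ⟧} {⟦ ds ⟧} difference≡
        (lowest-square lowest₀) (lowest-square c) (vanishing ds-relation ds-relation)
        where
        ds = upper x y z ++ -1ℤ ∙ upper x₀ y₀ z₀
        cancel : ∀ w u v → u ℤ.+ -1ℤ ℤ.* v ≡ 1ℤ ℤ.* w ℤ.+ u ℤ.- (1ℤ ℤ.* w ℤ.+ v)
        cancel = solve-∀
        weigh-ds : ∀ f → weigh f ds ≡ weigh f (upper x y z) ℤ.+ -1ℤ ℤ.* weigh f (upper x₀ y₀ z₀)
        weigh-ds f = trans (weigh-++ f (upper x y z) (-1ℤ ∙ upper x₀ y₀ z₀))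
          (cong (ℤ._+_ (weigh f (upper x y z))) (weigh-∙ f -1ℤ (upper x₀ y₀ z₀)))
        difference≡ : ∀ t → ⟦ ds ⟧ t ≡ ⟦ corner (s i) x y z ⟧ t ℤ.- v₀ t
        difference≡ t = trans (weigh-ds (λ p → δ p t))
          (cancel (δ (s i) t) (⟦ upper x y z ⟧ t) (⟦ upper x₀ y₀ z₀ ⟧ t))
        moments : ∀ m → ℤ.- m ℤ.+ -1ℤ ℤ.* (ℤ.- m) ≡ 0ℤ
        moments = solve-∀
        ds-relation : Relation (suc i) ds
        ds-relation = relation (All.++⁺ (upper∈ c) (∙-support -1ℤ (upper∈ lowest₀)))
          (weigh-ds (λ _ → 1ℤ))
          (trans (weigh-ds (λ p → + p)) (trans
            (cong₂ (λ u v → u ℤ.+ -1ℤ ℤ.* v) (upper-moment c) (upper-moment lowest₀)) (moments (+ s i))))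

      -- Strong induction on `j`, with `n` as its bound. Inside the window the linear system
      -- decides. Beyond it, j = 2 + l is the top of a corner through `s i` whose inner points have
      -- smaller index; since the error at `s i` is zero, the corner expresses the error at the top
      -- by the errors at these two points.
      v₀⊙error : ∀ n {j} → j < n → i ≤ j → j < N → P (v₀ ⊙ ⟦ interpolationError (s i) a (s j) ⟧)
      v₀⊙error (suc n) {j} (s≤s j≤n) i≤j j<N with ℕ.≤-<-connex (12 + i) j
      ... | inj₂ j<12+i = subst (λ k → P (v₀ ⊙ ⟦ interpolationError (s i) a (s k) ⟧)) (ℕ.m∸n+n≡m i≤j)
        (linear⇒ 12+i≤N v₀⊙-pure (λ x∈ y∈ z∈ c → v₀⊙lowest (lowest x∈ y∈ z∈ c)) (j ∸ i)
          (ℕ.+-cancelʳ-< i (j ∸ i) 12 (subst (_< 12 + i) (sym (ℕ.m∸n+n≡m i≤j)) j<12+i)))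
      ... | inj₁ (s≤s (s≤s {n = l} 10+i≤l)) =
        let k , j′ , k≡ , j′≡ , c = farCorner l (ℕ.≤-trans (ℕ.+-monoˡ-≤ i (s≤s (s≤s (s≤s (z≤n {7}))))) 10+i≤l) j<N
            k<N , i≤k , j′<N , i≤j′ , k<2+l , j′<2+l = bounds c k≡
        in respects v₀⊙-pure (solved {x = s (2 + l)} {s k} {s j′} (proj₂ (proj₂ (Lowest.corners c))))
          (linear v₀⊙-pure (+ a ℤ.- + s i) 1ℤ (v₀⊙lowest c)
            (linear v₀⊙-pure 1ℤ 1ℤ
              (v₀⊙error n (ℕ.<-≤-trans k<2+l j≤n) i≤k k<N)
              (v₀⊙error n (ℕ.<-≤-trans j′<2+l j≤n) i≤j′ j′<N)))
        where
        bounds : ∀ {k j′} → Lowest (s (2 + l)) (s k) (s j′) → k ≡ l ⊎ k ≡ suc l →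
          k < N × i ≤ k × j′ < N × i ≤ j′ × k < 2 + l × j′ < 2 + l
        bounds {k} {j′} (lowest _ _ _ (w<z , z<y , _)) k≡ =
          let i<j′ = s-cancel-< w<z
              j′<k = s-cancel-< z<y
              k<2+l = near k≡
              k<N = ℕ.<-trans k<2+l j<N
              i<k = ℕ.<-trans i<j′ j′<k
          in k<N , ℕ.<⇒≤ i<k , ℕ.<-trans j′<k k<N , ℕ.<⇒≤ i<j′ , k<2+l , ℕ.<-trans j′<k k<2+l
          where
          near : ∀ {k} → k ≡ l ⊎ k ≡ suc l → k < 2 + l
          near (inj₁ refl) = ℕ.n≤1+n _
          near (inj₂ refl) = ℕ.≤-refl
        isolate : ∀ w x y z → w ≡ 0ℤ → (w ℤ.+ x ℤ.- (y ℤ.+ z)) ℤ.+ 1ℤ ℤ.* (1ℤ ℤ.* y ℤ.+ 1ℤ ℤ.* z) ≡ x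
        isolate _ x y z refl = identity x y z
          where
          identity : ∀ x y z → (0ℤ ℤ.+ x ℤ.- (y ℤ.+ z)) ℤ.+ 1ℤ ℤ.* (1ℤ ℤ.* y ℤ.+ 1ℤ ℤ.* z) ≡ x
          identity = solve-∀
        solved : ∀ {x y z} → s i + x ≡ y + z → ∀ t →
          (+ a ℤ.- + s i) ℤ.* ⟦ corner (s i) x y z ⟧ t ℤ.+ 1ℤ ℤ.*
            (1ℤ ℤ.* ⟦ interpolationError (s i) a y ⟧ t ℤ.+ 1ℤ ℤ.* ⟦ interpolationError (s i) a z ⟧ t) ≡
          ⟦ interpolationError (s i) a x ⟧ t
        solved {x} {y} {z} e t = trans
          (cong (λ u → u ℤ.+ 1ℤ ℤ.* (1ℤ ℤ.* ⟦ interpolationError (s i) a y ⟧ t ℤ.+ 1ℤ ℤ.* ⟦ interpolationError (s i) a z ⟧ t))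
            (interpolationError-corner {s i} {a} {s i} {x} {y} {z} e t))
          (isolate (⟦ interpolationError (s i) a (s i) ⟧ t) (⟦ interpolationError (s i) a x ⟧ t)
            (⟦ interpolationError (s i) a y ⟧ t) (⟦ interpolationError (s i) a z ⟧ t)
            (interpolationError-left (s i) a t))

      v₀⊙relation : ∀ {cs} → Relation i cs → P (v₀ ⊙ ⟦ cs ⟧)
      v₀⊙relation = relation⇒ v₀⊙-pure (s<s-suc i) (λ {j} → v₀⊙error (suc j) ℕ.≤-refl)

      -- The interpolation points are now the two non-holes above `s i`. Errors at higher non-holes
      -- are then relations avoiding `s i`, so only the error at `s i` itself needs v₀.
      extend : ∀ {Q} → PureSubgroup Q → (∀ {cs} → Relation (suc i) cs → Q ⟦ cs ⟧) → Q v₀ →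
        ∀ {cs} → Relation i cs → Q ⟦ cs ⟧
      extend {Q} Q-pure q q₀ = relation⇒ Q-pure (s<s-suc (suc i)) at
        where
        a∈ : NonHoleFrom (suc i) a
        a∈ = suc i , ℕ.≤-refl , ℕ.<-≤-trans (ℕ.+-monoˡ-< i (s≤s (s≤s (z≤n {10})))) 12+i≤N , refl
        b∈ : NonHoleFrom (suc i) b
        b∈ = 2 + i , ℕ.n≤1+n _ , ℕ.<-≤-trans (ℕ.+-monoˡ-< i (s≤s (s≤s (s≤s (z≤n {9}))))) 12+i≤N , refl
        rest : Combination
        rest = (+ s i ℤ.- + b , a) ∷ (+ a ℤ.- + s i , b) ∷ (+ a ℤ.- + b) ∙ upper x₀ y₀ z₀
        weigh-rest : ∀ f → weigh f rest ≡
          (+ s i ℤ.- + b) ℤ.* f a ℤ.+ ((+ a ℤ.- + s i) ℤ.* f b ℤ.+ (+ a ℤ.- + b) ℤ.* weigh f (upper x₀ y₀ z₀))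
        weigh-rest f = cong (λ t → (+ s i ℤ.- + b) ℤ.* f a ℤ.+ ((+ a ℤ.- + s i) ℤ.* f b ℤ.+ t))
          (weigh-∙ f (+ a ℤ.- + b) (upper x₀ y₀ z₀))
        rest-total : ∀ m a b → (m ℤ.- b) ℤ.* 1ℤ ℤ.+ ((a ℤ.- m) ℤ.* 1ℤ ℤ.+ (a ℤ.- b) ℤ.* -1ℤ) ≡ 0ℤ
        rest-total = solve-∀
        rest-moment : ∀ m a b → (m ℤ.- b) ℤ.* a ℤ.+ ((a ℤ.- m) ℤ.* b ℤ.+ (a ℤ.- b) ℤ.* (ℤ.- m)) ≡ 0ℤ
        rest-moment = solve-∀
        rest-relation : Relation (suc i) rest
        rest-relation = relation (a∈ ∷ b∈ ∷ ∙-support (+ a ℤ.- + b) (upper∈ lowest₀))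
          (trans (weigh-rest (λ _ → 1ℤ)) (rest-total (+ s i) (+ a) (+ b)))
          (trans (weigh-rest (λ p → + p)) (trans
            (cong (λ t → (+ s i ℤ.- + b) ℤ.* + a ℤ.+ ((+ a ℤ.- + s i) ℤ.* + b ℤ.+ (+ a ℤ.- + b) ℤ.* t))
              (upper-moment lowest₀))
            (rest-moment (+ s i) (+ a) (+ b))))
        error-total : ∀ a b p → (b ℤ.- a) ℤ.* 1ℤ ℤ.+ ((p ℤ.- b) ℤ.* 1ℤ ℤ.+ ((a ℤ.- p) ℤ.* 1ℤ ℤ.+ 0ℤ)) ≡ 0ℤ
        error-total = solve-∀
        error-moment : ∀ a b p → (b ℤ.- a) ℤ.* p ℤ.+ ((p ℤ.- b) ℤ.* a ℤ.+ ((a ℤ.- p) ℤ.* b ℤ.+ 0ℤ)) ≡ 0ℤ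
        error-moment = solve-∀
        split : ∀ m a b w u x y →
          (b ℤ.- a) ℤ.* (1ℤ ℤ.* w ℤ.+ u) ℤ.+ 1ℤ ℤ.* ((m ℤ.- b) ℤ.* x ℤ.+ ((a ℤ.- m) ℤ.* y ℤ.+ (a ℤ.- b) ℤ.* u)) ≡
          (b ℤ.- a) ℤ.* w ℤ.+ ((m ℤ.- b) ℤ.* x ℤ.+ ((a ℤ.- m) ℤ.* y ℤ.+ 0ℤ))
        split = solve-∀
        at : ∀ {j} → i ≤ j → j < N → Q ⟦ interpolationError a b (s j) ⟧
        at {j} i≤j j<N with ℕ.m≤n⇒m<n∨m≡n i≤j
        ... | inj₁ i<j  = q {interpolationError a b (s j)} (relation ((j , i<j , j<N , refl) ∷ a∈ ∷ b∈ ∷ [])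
          (error-total (+ a) (+ b) (+ s j)) (error-moment (+ a) (+ b) (+ s j)))
        -- Subtracting (b - a) v₀ from the error at `s i` removes its coefficient there; `rest` is
        -- what remains.
        ... | inj₂ refl = respects Q-pure (λ t → trans
            (cong (λ r → (+ b ℤ.- + a) ℤ.* v₀ t ℤ.+ 1ℤ ℤ.* r) (weigh-rest (λ p → δ p t)))
            (split (+ s i) (+ a) (+ b) (δ (s i) t) (⟦ upper x₀ y₀ z₀ ⟧ t) (δ a t) (δ b t)))
          (linear Q-pure (+ b ℤ.- + a) 1ℤ q₀ (q rest-relation))

      lower-relation : ∀ {cs} → Relation (suc i) cs → Relation i cs
      lower-relation (relation support t m) = relation (All.map lower support) t m

      vanishing-lower : Vanishing i
      vanishing-lower {cs} {ds} rcs rds =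
        extend (⊙-pureˡ ⟦ ds ⟧) (λ r → half r rds) (v₀⊙relation rds) rcs
        where
        half : ∀ {cs ds} → Relation (suc i) cs → Relation i ds → P (⟦ cs ⟧ ⊙ ⟦ ds ⟧)
        half {cs} rcs rds = extend (⊙-pure P-pure ⟦ cs ⟧) (λ r → vanishing rcs r)
          (⊙-swap {v₀} {⟦ cs ⟧} (v₀⊙relation (lower-relation rcs))) rds

    vanishing : ∀ n i → n + (12 + i) ≡ N → Vanishing i
    vanishing zero    i e = base i e
    vanishing (suc n) i e = Step.vanishing-lower i
      (subst (12 + i <_) e (s≤s (ℕ.m≤n+m (12 + i) n)))
      (vanishing n (suc i) (trans (rearrange n i) e))
      where
      rearrange : ∀ n i → n + (12 + (1 + i)) ≡ 1 + n + (12 + i)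
      rearrange = ℕ-Solver.solve-∀

-- Integer vectors

isZero : ∀ {n} (x : Vector ℤ n) → (∀ i → x i ≡ 0ℤ) ⊎ ∃[ i ] x i ≢ 0ℤ
isZero x with Fin.all? (λ i → x i ℤ.≟ 0ℤ)
... | yes x≡0 = inj₁ x≡0
... | no x≢0  = inj₂ (Fin.¬∀⟶∃¬ _ _ (λ i → x i ℤ.≟ 0ℤ) x≢0)

sum-zero : ∀ {n} {t : Vector ℤ n} → (∀ i → t i ≡ 0ℤ) → sum t ≡ 0ℤ
sum-zero {n} t≡0 = trans (sum-cong-≗ t≡0) (sum-replicate-zero n)

sum-select : ∀ {n} {t : Vector ℤ n} i → (∀ j → j ≢ i → t j ≡ 0ℤ) → sum t ≡ t i
sum-select {suc n} {t} i t≡0 = trans (sum-remove {i = i} t)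
  (trans (cong (ℤ._+_ (t i)) (sum-zero (λ j → t≡0 (punchIn i j) (Fin.punchInᵢ≢i i j)))) (ℤ.+-identityʳ (t i)))

square-nonNeg : ∀ a → 0ℤ ℤ.≤ a ℤ.* a
square-nonNeg (+ n)      = subst (0ℤ ℤ.≤_) (ℤ.pos-* n n) (ℤ.+≤+ z≤n)
square-nonNeg ℤ.-[1+ n ] = ℤ.+≤+ z≤n

square-positive : ∀ {a} → a ≢ 0ℤ → 1ℤ ℤ.≤ a ℤ.* a
square-positive {+ zero}    a≢0 = contradiction refl a≢0
square-positive {+ suc n}   _   = ℤ.+≤+ (s≤s z≤n)
square-positive {ℤ.-[1+ n ]} _  = ℤ.+≤+ (s≤s z≤n)

norm-nonNeg : ∀ {n} (x : Vector ℤ n) → 0ℤ ℤ.≤ norm x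
norm-nonNeg {zero}  x = ℤ.≤-refl
norm-nonNeg {suc n} x = ℤ.+-mono-≤ (square-nonNeg (x zero)) (norm-nonNeg (x ∘ suc))

norm-remove : ∀ {n} (x : Vector ℤ (suc n)) i → norm x ≡ x i ℤ.* x i ℤ.+ norm (removeAt x i)
norm-remove x i = sum-remove (λ j → x j ℤ.* x j)

norm-positive : ∀ {n} (x : Vector ℤ n) {i} → x i ≢ 0ℤ → 1ℤ ℤ.≤ norm x
norm-positive {suc n} x {i} xi≢0 = subst (1ℤ ℤ.≤_) (sym (norm-remove x i))
  (ℤ.+-mono-≤ (square-positive xi≢0) (norm-nonNeg (removeAt x i)))

n[n+1]-even : ∀ n → ∃[ m ] n ℕ.* suc n ≡ 2 ℕ.* m
n[n+1]-even zero    = 0 , refl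
n[n+1]-even (suc n) = let m , e = n[n+1]-even n in m + suc n ,
  trans (expand n) (trans (cong (ℕ._+ 2 ℕ.* suc n) e) (sym (ℕ.*-distribˡ-+ 2 m (suc n))))
  where
  expand : ∀ n → (1 + n) ℕ.* (2 + n) ≡ n ℕ.* (1 + n) + 2 ℕ.* (1 + n)
  expand = ℕ-Solver.solve-∀

square-parity : ∀ a → ∃[ m ] a ℤ.* a ≡ a ℤ.+ + 2 ℤ.* m
square-parity (+ zero)  = 0ℤ , refl
square-parity (+ suc n) = let m , e = n[n+1]-even n in + m , (begin
  + suc n ℤ.* + suc n          ≡⟨ ℤ.pos-* (suc n) (suc n) ⟨
  + (suc n ℕ.* suc n)          ≡⟨ cong +_ (trans (expand n) (cong (suc n ℕ.+_) e)) ⟩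
  + (suc n + 2 ℕ.* m)          ≡⟨ ℤ.pos-+ (suc n) (2 ℕ.* m) ⟩
  + suc n ℤ.+ + (2 ℕ.* m)      ≡⟨ cong (ℤ._+_ (+ suc n)) (ℤ.pos-* 2 m) ⟩
  + suc n ℤ.+ + 2 ℤ.* + m      ∎)
  where
  open ≡-Reasoning
  expand : ∀ n → (1 + n) ℕ.* (1 + n) ≡ (1 + n) + n ℕ.* (1 + n)
  expand = ℕ-Solver.solve-∀
square-parity a@(ℤ.-[1+ n ]) = let m , e = square-parity (+ suc n) in m ℤ.+ + suc n ,
  trans e (lemma (+ suc n) m)
  where
  lemma : ∀ b m → b ℤ.+ + 2 ℤ.* m ≡ (ℤ.- b) ℤ.+ + 2 ℤ.* (m ℤ.+ b)
  lemma = solve-∀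

norm-parity : ∀ {n} (x : Vector ℤ n) → ∃[ m ] norm x ≡ sum x ℤ.+ + 2 ℤ.* m
norm-parity {zero}  x = 0ℤ , refl
norm-parity {suc n} x =
  let m , e = square-parity (x zero)
      k , f = norm-parity (x ∘ suc)
  in m ℤ.+ k , trans (cong₂ ℤ._+_ e f) (lemma (x zero) (sum (x ∘ suc)) m k)
  where
  lemma : ∀ a b m k → (a ℤ.+ + 2 ℤ.* m) ℤ.+ (b ℤ.+ + 2 ℤ.* k) ≡ (a ℤ.+ b) ℤ.+ + 2 ℤ.* (m ℤ.+ k)
  lemma = solve-∀

even≥3⇒≥4 : ∀ {a} m → a ≡ + 2 ℤ.* m → + 3 ℤ.≤ a → + 4 ℤ.≤ a
even≥3⇒≥4 m refl 3≤a = ℤ.*-monoˡ-≤-nonNeg (+ 2) (ℤ.i<j⇒suc[i]≤j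
  (ℤ.*-cancelˡ-<-nonNeg {+ 1} {m} (+ 2) (ℤ.<-≤-trans (ℤ.+<+ ℕ.≤-refl) 3≤a)))

-- The norm has the parity of the coordinate sum, so it is even, and at least three coordinates are
-- nonzero: a single one contradicts the sum, and two, being opposite, contradict the injectivity of
-- `σ` through the weighted sum.
norm≥4 : ∀ {d} (σ : Vector ℕ (2 + d)) → (∀ {i j} → σ i ≡ σ j → i ≡ j) → (x : Vector ℤ (2 + d)) →
  sum x ≡ 0ℤ → sum (λ i → + σ i ℤ.* x i) ≡ 0ℤ → ¬ (∀ i → x i ≡ 0ℤ) → + 4 ℤ.≤ norm x
norm≥4 {d} σ σ-injective x Σx≡0 Σσx≡0 x≢0 with isZero x
... | inj₁ x≡0 = contradiction x≡0 x≢0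
... | inj₂ (i , xi≢0) with isZero x′
  where x′ = removeAt x i
...   | inj₁ x′≡0 = contradiction
  (trans (sym (trans (sum-remove x) (trans (cong (ℤ._+_ (x i)) (sum-zero x′≡0)) (ℤ.+-identityʳ (x i))))) Σx≡0) xi≢0
...   | inj₂ (j , xj≢0) with isZero (removeAt (removeAt x i) j)
...     | inj₁ x″≡0 = contradiction (σ-injective (ℤ.+-injective (sym (ℤ.i-j≡0⇒i≡j _ _ σi-σj≡0))))
            (Fin.punchInᵢ≢i i j)
  where
  xj = x (punchIn i j)
  σj = σ (punchIn i j)
  two-terms : (t : Vector ℤ (2 + d)) → (∀ k → removeAt (removeAt t i) j k ≡ 0ℤ) →
    sum t ≡ t i ℤ.+ t (punchIn i j)
  two-terms t t≡0 = trans (sum-remove t) (cong (ℤ._+_ (t i))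
    (trans (sum-remove (removeAt t i)) (trans (cong (ℤ._+_ (t (punchIn i j))) (sum-zero t≡0)) (ℤ.+-identityʳ _))))
  first : x i ℤ.+ xj ≡ 0ℤ
  first = trans (sym (two-terms x x″≡0)) Σx≡0
  second : + σ i ℤ.* x i ℤ.+ + σj ℤ.* xj ≡ 0ℤ
  second = trans (sym (two-terms (λ k → + σ k ℤ.* x k)
    (λ k → trans (cong (ℤ._*_ (+ σ _)) (x″≡0 k)) (ℤ.*-zeroʳ (+ σ _))))) Σσx≡0
  combination : ∀ s t x y → (s ℤ.- t) ℤ.* x ≡ (s ℤ.* x ℤ.+ t ℤ.* y) ℤ.- t ℤ.* (x ℤ.+ y)
  combination = solve-∀
  product≡0 : (+ σ i ℤ.- + σj) ℤ.* x i ≡ 0ℤ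
  product≡0 = trans (combination (+ σ i) (+ σj) (x i) xj)
    (trans (cong₂ (λ u v → u ℤ.- + σj ℤ.* v) second first) (cong (λ u → 0ℤ ℤ.- u) (ℤ.*-zeroʳ (+ σj))))
  σi-σj≡0 : + σ i ℤ.- + σj ≡ 0ℤ
  σi-σj≡0 with ℤ.i*j≡0⇒i≡0∨j≡0 (+ σ i ℤ.- + σj) product≡0
  ... | inj₁ e = e
  ... | inj₂ e = contradiction e xi≢0
...     | inj₂ (k , xk≢0) = even≥3⇒≥4 m
  (trans e (trans (cong (ℤ._+ + 2 ℤ.* m) Σx≡0) (ℤ.+-identityˡ _)))
  (subst (+ 3 ℤ.≤_) (sym (trans (norm-remove x i) (cong (ℤ._+_ (x i ℤ.* x i)) (norm-remove (removeAt x i) j))))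
    (ℤ.+-mono-≤ (square-positive xi≢0) (ℤ.+-mono-≤ (square-positive xj≢0) (norm-positive (removeAt (removeAt x i) j) xk≢0))))
  where
  m = proj₁ (norm-parity x)
  e = proj₂ (norm-parity x)

-- Hole sequences

-- Membership in the lattice carries its own enumeration of the non-holes, which has to be matched
-- with the constructed one. If `s′ i < s i`, then `s′ i` is `s k` for some k < i, so `s′ k < s k`,
-- against the induction hypothesis.
smallest-unique : ∀ {h n} {s s′ : Vector ℕ n} → SmallestNonHoles h s → SmallestNonHoles h s′ →
  ∀ i → s i ≡ s′ i
smallest-unique {h} {n} p q i =
  ℕ.≤-antisym (below p q i (Fin.<-wellFounded i)) (below q p i (Fin.<-wellFounded i))
  where
  open SmallestNonHoles
  below : ∀ {s s′ : Vector ℕ n} → SmallestNonHoles h s → SmallestNonHoles h s′ →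
    ∀ i → Fin.Acc Fin._<_ i → s i ≤ s′ i
  below {s} {s′} p q i (Fin.acc rec) = ℕ.≮⇒≥ λ s′i<si →
    let k , s′i≡sk = smallest p i (nonHole q i) (ℕ.<⇒≤ s′i<si)
        k<i = earlier (subst (_< s i) s′i≡sk s′i<si)
    in ℕ.<-irrefl refl (ℕ.<-≤-trans (increasing q k<i) (subst (_≤ s′ k) (sym s′i≡sk) (below p q k (rec k<i))))
    where
    earlier : ∀ {k} → s k < s i → k Fin.< i
    earlier {k} sk<si with Fin.<-cmp k i
    ... | tri< k<i _ _  = k<i
    ... | tri≈ _ refl _ = contradiction sk<si (ℕ.<-irrefl refl)
    ... | tri> _ _ i<k  = contradiction sk<si (ℕ.<⇒≯ (increasing p i<k))

Apart : ℕ → ℕ → Set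
Apart a b = a + 6 ≤ b

Apart-trans : ∀ {a b c} → Apart a b → Apart b c → Apart a c
Apart-trans {b = b} a+6≤b b+6≤c = ℕ.≤-trans a+6≤b (ℕ.≤-trans (ℕ.m≤m+n b 6) b+6≤c)

infinite-apart : (h : ℕ → ℕ) → (∀ i → Apart (h i) (h (suc i))) → ∀ {i j} → i < j → Apart (h i) (h j)
infinite-apart h apart {i} {suc j} (s≤s i≤j) with ℕ.m≤n⇒m<n∨m≡n i≤j
... | inj₁ i<j  = Apart-trans (infinite-apart h apart i<j) (apart j)
... | inj₂ refl = apart j

holes-comparable : (h : Sequence) → Consecutive Apart h →
  ∀ {p q} → p ∈ₛ h → q ∈ₛ h → Apart p q ⊎ p ≡ q ⊎ Apart q p
holes-comparable (finite hs) apart = compare (Linked⇒AllPairs Apart-trans apart)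
  where
  compare : ∀ {hs p q} → AllPairs Apart hs → p ∈ hs → q ∈ hs → Apart p q ⊎ p ≡ q ⊎ Apart q p
  compare (_ ∷ _)   (here refl) (here refl) = inj₂ (inj₁ refl)
  compare (px ∷ _)  (here refl) (there q∈)  = inj₁ (All.lookup px q∈)
  compare (px ∷ _)  (there p∈)  (here refl) = inj₂ (inj₂ (All.lookup px p∈))
  compare (_ ∷ pxs) (there p∈)  (there q∈)  = compare pxs p∈ q∈
holes-comparable (infinite h) apart (i , refl) (j , refl) with ℕ.<-cmp i j
... | tri< i<j _ _  = inj₁ (infinite-apart h apart i<j)
... | tri≈ _ refl _ = inj₂ (inj₁ refl)
... | tri> _ _ j<i  = inj₂ (inj₂ (infinite-apart h apart j<i))

holes-spaced : (h : Sequence) → Consecutive Apart h →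
  ∀ {p q} → p ∈ₛ h → q ∈ₛ h → p < q → Apart p q
holes-spaced h apart {p} {q} p∈ q∈ p<q with holes-comparable h apart p∈ q∈
... | inj₁ pq        = pq
... | inj₂ (inj₁ refl) = contradiction p<q (ℕ.<-irrefl refl)
... | inj₂ (inj₂ qp) = contradiction p<q (ℕ.≤⇒≯ (ℕ.≤-trans (ℕ.m≤m+n q 6) qp))

-- The i-th term of an infinite sequence is at least i, so membership is a bounded search.
hole? : (h : Sequence) → Consecutive Apart h → Decidable (_∈ₛ h)
hole? (finite hs)  _     p = p ∈? hs
hole? (infinite h) apart p =
  map′ (λ (i , _ , e) → i , e) (λ { (i , refl) → i , s≤s (i≤h i) , refl }) (ℕ.anyUpTo? (λ i → p ℕ.≟ h i) (suc p))
  where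
  i≤h : ∀ i → i ≤ h i
  i≤h zero    = z≤n
  i≤h (suc i) = ℕ.≤-trans (s≤s (i≤h i)) (ℕ.≤-trans (ℕ.m<m+n (h i) (s≤s z≤n)) (apart i))

-- The lattice, its minimal vectors and its minimum

module Nonholes (d : ℕ) (10≤d : 10 ≤ d) (h : Sequence) (apart : Consecutive Apart h) where

  open NonHoles (_∈ₛ h) (hole? h apart) (holes-spaced h apart)
  open Core (_∈ₛ h) (hole? h apart) (holes-spaced h apart) (2 + d)

  σ : Vector ℕ (2 + d)
  σ = s ∘ toℕ

  σ-injective : ∀ {i j} → σ i ≡ σ j → i ≡ j
  σ-injective e = Fin.toℕ-injective (s-injective e)

  σ-smallest : SmallestNonHoles h σ
  σ-smallest = record
    { increasing = s-mono-<
    ; nonHole    = λ i → s-positive (toℕ i) , nonHole-s (toℕ i)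
    ; smallest   = λ j (0<k , ¬hk) k≤σj →
        let i , i≤j , k≡si = s-complete (toℕ j) 0<k ¬hk k≤σj
            i<2+d = ℕ.≤-<-trans i≤j (Fin.toℕ<n j)
        in Fin.fromℕ< i<2+d , trans k≡si (cong s (sym (Fin.toℕ-fromℕ< i<2+d)))
    }

  σ-NonHole : ∀ i → NonHoleFrom 0 (σ i)
  σ-NonHole i = toℕ i , z≤n , Fin.toℕ<n i , refl

  index : ∀ {p} → NonHoleFrom 0 p → ∃[ i ] p ≡ σ i
  index (j , _ , j<N , refl) = Fin.fromℕ< j<N , cong s (sym (Fin.toℕ-fromℕ< j<N))

  L⇒sums : ∀ {x} → L[ d ] h x → sum x ≡ 0ℤ × sum (λ i → + σ i ℤ.* x i) ≡ 0ℤ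
  L⇒sums {x} (Σx≡0 , s′ , s′-smallest , Σs′x≡0) = Σx≡0 , trans
    (sum-cong-≗ (λ i → cong (λ p → + p ℤ.* x i) (smallest-unique σ-smallest s′-smallest i))) Σs′x≡0

  L-norm≥4 : ∀ x → L[ d ] h x → ¬ (∀ i → x i ≡ 0ℤ) → + 4 ℤ.≤ norm x
  L-norm≥4 x x∈L = let Σx≡0 , Σσx≡0 = L⇒sums {x} x∈L in norm≥4 σ σ-injective x Σx≡0 Σσx≡0

  combination : Vector ℤ (2 + d) → Combination
  combination x = List.tabulate (λ i → x i , σ i)

  weigh-tabulate : ∀ {n} f (x : Vector ℤ n) (p : Vector ℕ n) →
    weigh f (List.tabulate (λ i → x i , p i)) ≡ sum (λ i → x i ℤ.* f (p i))
  weigh-tabulate {zero}  f x p = refl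
  weigh-tabulate {suc n} f x p = cong (ℤ._+_ (x zero ℤ.* f (p zero))) (weigh-tabulate f (x ∘ suc) (p ∘ suc))

  δ-refl : ∀ p → δ p p ≡ 1ℤ
  δ-refl p with p ℕ.≡ᵇ p in e
  ... | true  = refl
  ... | false = contradiction (ℕ.≡⇒≡ᵇ p p refl) (subst (λ b → ¬ T b) (sym e) (λ ()))

  δ-≢ : ∀ {p q} → p ≢ q → δ p q ≡ 0ℤ
  δ-≢ {p} {q} p≢q with p ℕ.≡ᵇ q in e
  ... | false = refl
  ... | true  = contradiction (ℕ.≡ᵇ⇒≡ p q (subst T (sym e) _)) p≢q

  combination-value : ∀ x i → ⟦ combination x ⟧ (σ i) ≡ x i
  combination-value x i = trans (weigh-tabulate (λ p → δ p (σ i)) x σ)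
    (trans (sum-select i (λ j j≢i → trans
        (cong (ℤ._*_ (x j)) (δ-≢ (j≢i ∘ σ-injective))) (ℤ.*-zeroʳ (x j))))
      (trans (cong (ℤ._*_ (x i)) (δ-refl (σ i))) (ℤ.*-identityʳ (x i))))

  combination-relation : ∀ {x} → L[ d ] h x → Relation 0 (combination x)
  combination-relation {x} x∈L = let Σx≡0 , Σσx≡0 = L⇒sums {x} x∈L in relation
    (All.tabulate⁺ {f = λ i → x i , σ i} σ-NonHole)
    (trans (weigh-tabulate _ x σ) (trans (sum-cong-≗ (λ i → ℤ.*-identityʳ (x i))) Σx≡0))
    (trans (weigh-tabulate _ x σ) (trans (sum-cong-≗ (λ i → ℤ.*-comm (x i) (+ σ i))) Σσx≡0))

  sum-δ : ∀ (f : ℕ → ℤ) {p} → NonHoleFrom 0 p → sum (λ i → f (σ i) ℤ.* δ p (σ i)) ≡ f p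
  sum-δ f {p} p∈ with index p∈
  ... | j , refl = trans
    (sum-select j (λ i i≢j → trans (cong (ℤ._*_ (f (σ i))) (δ-≢ (λ e → i≢j (σ-injective (sym e))))) (ℤ.*-zeroʳ (f (σ i)))))
    (trans (cong (ℤ._*_ (f (σ j))) (δ-refl (σ j))) (ℤ.*-identityʳ (f (σ j))))

  -- Passes from the sums over coordinates that define the lattice and the norm to formal
  -- combinations; the support condition ensures that restricting to the first d + 2 non-holes loses
  -- nothing.
  sum-weigh : ∀ (f : ℕ → ℤ) cs → All (NonHoleFrom 0 ∘ proj₂) cs →
    sum (λ i → f (σ i) ℤ.* ⟦ cs ⟧ (σ i)) ≡ weigh f cs
  sum-weigh f [] [] = sum-zero {2 + d} (λ i → ℤ.*-zeroʳ (f (σ i)))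
  sum-weigh f ((c , p) ∷ cs) (p∈ ∷ ps) = begin
    sum (λ i → f (σ i) ℤ.* (c ℤ.* δ p (σ i) ℤ.+ ⟦ cs ⟧ (σ i)))
      ≡⟨ sum-cong-≗ (λ i → distribute (f (σ i)) c (δ p (σ i)) (⟦ cs ⟧ (σ i))) ⟩
    sum (λ i → c ℤ.* (f (σ i) ℤ.* δ p (σ i)) ℤ.+ f (σ i) ℤ.* ⟦ cs ⟧ (σ i))
      ≡⟨ ∑-distrib-+ (λ i → c ℤ.* (f (σ i) ℤ.* δ p (σ i))) (λ i → f (σ i) ℤ.* ⟦ cs ⟧ (σ i)) ⟩
    sum (λ i → c ℤ.* (f (σ i) ℤ.* δ p (σ i))) ℤ.+ sum (λ i → f (σ i) ℤ.* ⟦ cs ⟧ (σ i))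
      ≡⟨ cong₂ ℤ._+_ (sym (*-distribˡ-sum c (λ i → f (σ i) ℤ.* δ p (σ i)))) (sum-weigh f cs ps) ⟩
    c ℤ.* sum (λ i → f (σ i) ℤ.* δ p (σ i)) ℤ.+ weigh f cs
      ≡⟨ cong (λ t → c ℤ.* t ℤ.+ weigh f cs) (sum-δ f p∈) ⟩
    c ℤ.* f p ℤ.+ weigh f cs ∎
    where
    open ≡-Reasoning
    distribute : ∀ f c e r → f ℤ.* (c ℤ.* e ℤ.+ r) ≡ c ℤ.* (f ℤ.* e) ℤ.+ f ℤ.* r
    distribute = solve-∀

  module _ {w x y z} (w∈ : NonHoleFrom 0 w) (x∈ : NonHoleFrom 0 x) (y∈ : NonHoleFrom 0 y) (z∈ : NonHoleFrom 0 z)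
    (corners : Corners w x y z) where

    private
      v = ⟦ corner w x y z ⟧
      all∈ : All (NonHoleFrom 0 ∘ proj₂) (corner w x y z)
      all∈ = w∈ ∷ x∈ ∷ y∈ ∷ z∈ ∷ []
      w<z = proj₁ corners
      z<y = proj₁ (proj₂ corners)
      w+x≡y+z = proj₂ (proj₂ corners)
      w<y = ℕ.<-trans w<z z<y
      y<x : y < x
      y<x = ℕ.≰⇒> λ x≤y → ℕ.<⇒≢ (ℕ.+-mono-<-≤ w<z x≤y) (trans w+x≡y+z (ℕ.+-comm y z))
      z<x = ℕ.<-trans z<y y<x
      w<x = ℕ.<-trans w<y y<x

      value : ∀ {t a b c e} → δ w t ≡ a → δ x t ≡ b → δ y t ≡ c → δ z t ≡ e →
        v t ≡ 1ℤ ℤ.* a ℤ.+ (1ℤ ℤ.* b ℤ.+ (-1ℤ ℤ.* c ℤ.+ (-1ℤ ℤ.* e ℤ.+ 0ℤ)))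
      value refl refl refl refl = refl

      below : ∀ {p q} → p < q → δ p q ≡ 0ℤ
      below p<q = δ-≢ (ℕ.<⇒≢ p<q)
      above : ∀ {p q} → q < p → δ p q ≡ 0ℤ
      above q<p = δ-≢ (ℕ.>⇒≢ q<p)

      v-w : v w ≡ 1ℤ
      v-w = value (δ-refl w) (above w<x) (above w<y) (above w<z)
      v-x : v x ≡ 1ℤ
      v-x = value (below w<x) (δ-refl x) (below y<x) (below z<x)
      v-y : v y ≡ -1ℤ
      v-y = value (below w<y) (above y<x) (δ-refl y) (below z<y)
      v-z : v z ≡ -1ℤ
      v-z = value (below w<z) (above z<x) (above z<y) (δ-refl z)

      four : ∀ {a b c e} → a ≡ 1ℤ → b ≡ 1ℤ → c ≡ -1ℤ → e ≡ -1ℤ →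
        1ℤ ℤ.* a ℤ.+ (1ℤ ℤ.* b ℤ.+ (-1ℤ ℤ.* c ℤ.+ (-1ℤ ℤ.* e ℤ.+ 0ℤ))) ≡ + 4
      four refl refl refl refl = refl

    -- Pairing the corner with itself by `sum-weigh` leaves v(w) + v(x) - v(y) - v(z).
    corner-norm : norm (v ∘ σ) ≡ + 4
    corner-norm = trans (sum-weigh v (corner w x y z) all∈) (four v-w v-x v-y v-z)

    corner-minimal : IsMinimal (L[ d ] h) (v ∘ σ)
    corner-minimal =
      ( trans (sum-cong-≗ (λ i → sym (ℤ.*-identityˡ (v (σ i))))) (sum-weigh (λ _ → 1ℤ) (corner w x y z) all∈)
      , σ , σ-smallest
      , trans (sum-weigh (λ p → + p) (corner w x y z) all∈) (trans (rearrange (+ w) (+ x) (+ y) (+ z))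
          (trans (cong (ℤ._- (+ y ℤ.+ + z)) (cast-+ {w} {x} {y} {z} w+x≡y+z)) (ℤ.+-inverseʳ (+ y ℤ.+ + z))))) ,
      nonzero (index w∈) , λ u u∈L u≢0 → subst (ℤ._≤ norm u) (sym corner-norm) (L-norm≥4 u u∈L u≢0)
      where
      rearrange : ∀ w x y z → 1ℤ ℤ.* w ℤ.+ (1ℤ ℤ.* x ℤ.+ (-1ℤ ℤ.* y ℤ.+ (-1ℤ ℤ.* z ℤ.+ 0ℤ))) ≡ w ℤ.+ x ℤ.- (y ℤ.+ z)
      rearrange = solve-∀
      nonzero : ∃[ i ] w ≡ σ i → ¬ (∀ i → v (σ i) ≡ 0ℤ)
      nonzero (i , w≡σi) v≡0 with trans (sym v-w) (trans (cong v w≡σi) (v≡0 i))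
      ... | ()

  hasMinimum : HasMinimum (L[ d ] h) (+ 4)
  hasMinimum =
    -- With i = 0 and l = 3 the inner indices are 1 or 2 and 3 or 4, so the four points are distinct
    -- and the order is clear.
    let k , j , k≡ , j≡ , e = parallelogram 0 3
        j<k = lt j≡ k≡
        k<5 = bound k≡
    in _ , corner-minimal {s 0} {s 5} {s k} {s j} (s∈ (s≤s z≤n)) (s∈ (s≤s (s≤s (s≤s (s≤s (s≤s (s≤s z≤n)))))))
        (s∈ (ℕ.≤-trans k<5 5≤12)) (s∈ (ℕ.≤-trans (ℕ.<-trans j<k k<5) 5≤12)) (s-mono-< (pos j≡) , s-mono-< j<k , e)
      , corner-norm (s∈ (s≤s z≤n)) (s∈ (s≤s (s≤s (s≤s (s≤s (s≤s (s≤s z≤n)))))))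
        (s∈ (ℕ.≤-trans k<5 5≤12)) (s∈ (ℕ.≤-trans (ℕ.<-trans j<k k<5) 5≤12)) (s-mono-< (pos j≡) , s-mono-< j<k , e)
    where
    5≤12 : 5 ≤ 12
    5≤12 = s≤s (s≤s (s≤s (s≤s (s≤s z≤n))))
    s∈ : ∀ {j} → j < 12 → NonHoleFrom 0 (s j)
    s∈ {j} j<12 = j , z≤n , ℕ.<-≤-trans j<12 (s≤s (s≤s 10≤d)) , refl
    pos : ∀ {j} → j ≡ 1 ⊎ j ≡ 2 → 0 < j
    pos (inj₁ refl) = s≤s z≤n
    pos (inj₂ refl) = s≤s z≤n
    lt : ∀ {j k} → j ≡ 1 ⊎ j ≡ 2 → k ≡ 3 ⊎ k ≡ 4 → j < k
    lt (inj₁ refl) (inj₁ refl) = s≤s (s≤s z≤n)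
    lt (inj₁ refl) (inj₂ refl) = s≤s (s≤s z≤n)
    lt (inj₂ refl) (inj₁ refl) = s≤s (s≤s (s≤s z≤n))
    lt (inj₂ refl) (inj₂ refl) = s≤s (s≤s (s≤s z≤n))
    bound : ∀ {k} → k ≡ 3 ⊎ k ≡ 4 → k < 5
    bound (inj₁ refl) = s≤s (s≤s (s≤s (s≤s z≤n)))
    bound (inj₂ refl) = s≤s (s≤s (s≤s (s≤s (s≤s z≤n))))

ℚ-ring : AlmostCommutativeRing 0ℓ 0ℓ
ℚ-ring = fromCommutativeRing ℚ.+-*-commutativeRing (λ q → dec⇒maybe (0ℚ ℚ.≟ q))

-- Sequences of rationals tending to zero

Null : (ℕ → ℚ) → Set
Null f = ∀ ε → 0ℚ ℚ.< ε → ∃[ N ] (∀ n → N ≤ n → ℚ.∣ f n ∣ ℚ.< ε)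

null-respects : ∀ {f g} → f ≗ g → Null f → Null g
null-respects f≗g nf ε 0<ε = let N , b = nf ε 0<ε in
  N , λ n N≤n → subst (λ q → ℚ.∣ q ∣ ℚ.< ε) (f≗g n) (b n N≤n)

null-+ : ∀ {f g} → Null f → Null g → Null (λ n → f n ℚ.+ g n)
null-+ {f} {g} nf ng ε 0<ε =
  let M , bf = nf (½ ℚ.* ε) 0<½ε
      N , bg = ng (½ ℚ.* ε) 0<½ε
  in M ⊔ N , λ n M⊔N≤n → begin-strict
    ℚ.∣ f n ℚ.+ g n ∣          ≤⟨ ℚ.∣p+q∣≤∣p∣+∣q∣ (f n) (g n) ⟩
    ℚ.∣ f n ∣ ℚ.+ ℚ.∣ g n ∣    <⟨ ℚ.+-mono-< (bf n (ℕ.m⊔n≤o⇒m≤o M N M⊔N≤n)) (bg n (ℕ.m⊔n≤o⇒n≤o M N M⊔N≤n)) ⟩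
    ½ ℚ.* ε ℚ.+ ½ ℚ.* ε        ≡⟨ ℚ.*-distribʳ-+ ε ½ ½ ⟨
    1ℚ ℚ.* ε                   ≡⟨ ℚ.*-identityˡ ε ⟩
    ε                          ∎
  where
  open ℚ.≤-Reasoning
  0<½ε : 0ℚ ℚ.< ½ ℚ.* ε
  0<½ε = ℚ.*-monoʳ-<-pos ½ {{_}} 0<ε

null-neg : ∀ {f} → Null f → Null (λ n → ℚ.- f n)
null-neg {f} nf ε 0<ε = let N , b = nf ε 0<ε in
  N , λ n N≤n → subst (ℚ._< ε) (sym (ℚ.∣-p∣≡∣p∣ (f n))) (b n N≤n)

cauchy-bounded : (x : ℝ) → ∃[ B ] 0ℚ ℚ.< B × ∃[ N ] (∀ n → N ≤ n → ℚ.∣ approx x n ∣ ℚ.≤ B)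
cauchy-bounded x = let N , c = cauchy x 1ℚ (ℚ.positive⁻¹ 1ℚ) in
  1ℚ ℚ.+ ℚ.∣ approx x N ∣ , ℚ.+-mono-<-≤ (ℚ.positive⁻¹ 1ℚ) (ℚ.0≤∣p∣ (approx x N)) ,
  N , λ n N≤n → begin
    ℚ.∣ approx x n ∣
      ≡⟨ cong ℚ.∣_∣ (split (approx x n) (approx x N)) ⟩
    ℚ.∣ (approx x n ℚ.- approx x N) ℚ.+ approx x N ∣
      ≤⟨ ℚ.∣p+q∣≤∣p∣+∣q∣ (approx x n ℚ.- approx x N) (approx x N) ⟩
    ℚ.∣ approx x n ℚ.- approx x N ∣ ℚ.+ ℚ.∣ approx x N ∣
      ≤⟨ ℚ.+-monoˡ-≤ ℚ.∣ approx x N ∣ (ℚ.<⇒≤ (c n N N≤n ℕ.≤-refl)) ⟩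
    1ℚ ℚ.+ ℚ.∣ approx x N ∣ ∎
  where
  open ℚ.≤-Reasoning
  split : ∀ a b → a ≡ (a ℚ.- b) ℚ.+ b
  split = RingSolver.solve-∀ ℚ-ring

reciprocal : ∀ B .{{_ : ℚ.Positive B}} → ℚ
reciprocal B = (ℚ.1/ B) {{ℚ.pos⇒nonZero B}}

∣p*q∣<ε : ∀ {B ε p q} .{{_ : ℚ.Positive B}} →
  ℚ.∣ p ∣ ℚ.≤ B → ℚ.∣ q ∣ ℚ.< reciprocal B ℚ.* ε → ℚ.∣ p ℚ.* q ∣ ℚ.< ε
∣p*q∣<ε {B} {ε} {p} {q} p≤B q<ε/B = begin-strict
  ℚ.∣ p ℚ.* q ∣           ≡⟨ ℚ.∣p*q∣≡∣p∣*∣q∣ p q ⟩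
  ℚ.∣ p ∣ ℚ.* ℚ.∣ q ∣     ≤⟨ ℚ.*-monoʳ-≤-nonNeg ℚ.∣ q ∣ {{ℚ.∣-∣-nonNeg q}} p≤B ⟩
  B ℚ.* ℚ.∣ q ∣           <⟨ ℚ.*-monoʳ-<-pos B q<ε/B ⟩
  B ℚ.* (reciprocal B ℚ.* ε)    ≡⟨ ℚ.*-assoc B (reciprocal B) ε ⟨
  (B ℚ.* reciprocal B) ℚ.* ε    ≡⟨ cong (ℚ._* ε) (ℚ.*-inverseʳ B {{ℚ.pos⇒nonZero B}}) ⟩
  1ℚ ℚ.* ε                ≡⟨ ℚ.*-identityˡ ε ⟩
  ε                       ∎
  where open ℚ.≤-Reasoning

0<ε/B : ∀ {B ε} .{{_ : ℚ.Positive B}} → 0ℚ ℚ.< ε → 0ℚ ℚ.< reciprocal B ℚ.* ε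
0<ε/B {B} {ε} 0<ε =
  ℚ.positive⁻¹ (reciprocal B ℚ.* ε) {{ℚ.pos*pos⇒pos (reciprocal B) {{ℚ.1/pos⇒pos B}} ε {{ℚ.positive 0<ε}}}}

bounded*null : ∀ {b f : ℕ → ℚ} B M .{{_ : ℚ.Positive B}} →
  (∀ n → M ≤ n → ℚ.∣ b n ∣ ℚ.≤ B) → Null f → Null (λ n → b n ℚ.* f n)
bounded*null {b} {f} B M bounded nf ε 0<ε =
  let N , small = nf (reciprocal B ℚ.* ε) (0<ε/B {B} {ε} 0<ε) in
  M ⊔ N , λ n M⊔N≤n → ∣p*q∣<ε {B} {ε} {b n} {f n}
    (bounded n (ℕ.m⊔n≤o⇒m≤o M N M⊔N≤n)) (small n (ℕ.m⊔n≤o⇒n≤o M N M⊔N≤n))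

null-* : ∀ {f} (x : ℝ) → Null f → Null (λ n → approx x n ℚ.* f n)
null-* {f} x nf = let B , 0<B , N , bounded = cauchy-bounded x in
  bounded*null {approx x} {f} B N {{ℚ.positive 0<B}} bounded nf

-- Real arithmetic up to ≈ᵣ

pointwise⇒≈ : ∀ {x y} → approx x ≗ approx y → x ≈ᵣ y
pointwise⇒≈ {x} {y} e ε 0<ε = 0 , λ n _ →
  subst (λ q → ℚ.∣ q ∣ ℚ.< ε) (sym (trans (cong (ℚ._- approx y n) (e n)) (ℚ.+-inverseʳ (approx y n)))) 0<ε

≈-refl : ∀ {x} → x ≈ᵣ x
≈-refl {x} = pointwise⇒≈ {x} {x} (λ _ → refl)

≈-sym : ∀ {x y} → x ≈ᵣ y → y ≈ᵣ x
≈-sym {x} {y} e = null-respects (λ n → lemma (approx x n) (approx y n)) (null-neg e)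
  where
  lemma : ∀ a b → ℚ.- (a ℚ.- b) ≡ b ℚ.- a
  lemma = RingSolver.solve-∀ ℚ-ring

≈-trans : ∀ {x y z} → x ≈ᵣ y → y ≈ᵣ z → x ≈ᵣ z
≈-trans {x} {y} {z} e f = null-respects (λ n → lemma (approx x n) (approx y n) (approx z n)) (null-+ e f)
  where
  lemma : ∀ a b c → (a ℚ.- b) ℚ.+ (b ℚ.- c) ≡ a ℚ.- c
  lemma = RingSolver.solve-∀ ℚ-ring

+ᵣ-cong : ∀ {x x′ y y′} → x ≈ᵣ x′ → y ≈ᵣ y′ → x +ᵣ y ≈ᵣ x′ +ᵣ y′
+ᵣ-cong {x} {x′} {y} {y′} e f = null-respects
  (λ n → lemma (approx x n) (approx x′ n) (approx y n) (approx y′ n)) (null-+ e f)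
  where
  lemma : ∀ a b c d → (a ℚ.- b) ℚ.+ (c ℚ.- d) ≡ (a ℚ.+ c) ℚ.- (b ℚ.+ d)
  lemma = RingSolver.solve-∀ ℚ-ring

*ᵣ-cong : ∀ {x x′ y y′} → x ≈ᵣ x′ → y ≈ᵣ y′ → x *ᵣ y ≈ᵣ x′ *ᵣ y′
*ᵣ-cong {x} {x′} {y} {y′} e f = null-respects
  (λ n → lemma (approx x n) (approx x′ n) (approx y n) (approx y′ n)) (null-+ (null-* y e) (null-* x′ f))
  where
  lemma : ∀ a b c d → c ℚ.* (a ℚ.- b) ℚ.+ b ℚ.* (c ℚ.- d) ≡ a ℚ.* c ℚ.- b ℚ.* d
  lemma = RingSolver.solve-∀ ℚ-ring

1ᵣ ½ᵣ : ℝ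
1ᵣ = fromℚ 1ℚ
½ᵣ = fromℚ ½

-- Subspaces of ℝᴵ

-- A tuple rather than a record, whose checking would unfold the Cauchy proofs inside _*ᵣ_.

module _ {I : Set} (Q : Pred (I → ℝ) 0ℓ) where

  Respects Linear Subspace : Set
  Respects = ∀ {f g} → (∀ i → f i ≈ᵣ g i) → Q f → Q g
  Linear   = ∀ c {f g} → Q f → Q g → Q (λ i → c *ᵣ f i +ᵣ g i)
  Subspace = Respects × Q (λ _ → 0ᵣ) × Linear

module _ {I : Set} {Q : Pred (I → ℝ) 0ℓ} (Q-sub : Subspace Q) where

  respectsᵣ : Respects Q
  respectsᵣ = proj₁ Q-sub

  zero∈ᵣ : Q (λ _ → 0ᵣ)
  zero∈ᵣ = proj₁ (proj₂ Q-sub)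

  linearᵣ : Linear Q
  linearᵣ = proj₂ (proj₂ Q-sub)

module _ {I A : Set} (f : A → I → ℝ) where

  span-least : ∀ {Q} → Subspace Q → (∀ a → Q (f a)) → Span f ⊆ Q
  span-least {Q} Q-sub gen {x} (cs , x≈) = respectsᵣ Q-sub {linearCombination f cs} {x}
    (λ i → ≈-sym {x i} {linearCombination f cs i} (x≈ i)) (combination∈ cs)
    where
    combination∈ : ∀ cs → Q (linearCombination f cs)
    combination∈ []             = zero∈ᵣ Q-sub
    combination∈ ((c , a) ∷ cs) = respectsᵣ Q-sub
      (λ i → pointwise⇒≈ {c *ᵣ f a i +ᵣ linearCombination f cs i} {linearCombination f ((c , a) ∷ cs) i} (λ _ → refl))
      (linearᵣ Q-sub c {f a} {linearCombination f cs} (gen a) (combination∈ cs))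

  linearCombination-linearᵣ : ∀ c cs ds i →
    linearCombination f (List.map (map₁ (c *ᵣ_)) cs ++ ds) i ≈ᵣ
    c *ᵣ linearCombination f cs i +ᵣ linearCombination f ds i
  linearCombination-linearᵣ c cs ds i = pointwise⇒≈
    {linearCombination f (List.map (map₁ (c *ᵣ_)) cs ++ ds) i}
    {c *ᵣ linearCombination f cs i +ᵣ linearCombination f ds i} (go cs)
    where
    go : ∀ cs n → approx (linearCombination f (List.map (map₁ (c *ᵣ_)) cs ++ ds) i) n ≡
      approx c n ℚ.* approx (linearCombination f cs i) n ℚ.+ approx (linearCombination f ds i) n
    go [] n = sym (trans (cong (ℚ._+ approx (linearCombination f ds i) n) (ℚ.*-zeroʳ (approx c n))) (ℚ.+-identityˡ _))
    go ((b , a) ∷ cs) n = trans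
      (cong ((approx c n ℚ.* approx b n) ℚ.* approx (f a i) n ℚ.+_) (go cs n))
      (lemma (approx c n) (approx b n) (approx (f a i) n)
        (approx (linearCombination f cs i) n) (approx (linearCombination f ds i) n))
      where
      lemma : ∀ c b v s t → (c ℚ.* b) ℚ.* v ℚ.+ (c ℚ.* s ℚ.+ t) ≡ c ℚ.* (b ℚ.* v ℚ.+ s) ℚ.+ t
      lemma = RingSolver.solve-∀ ℚ-ring

  span-respectsᵣ : Respects (Span f)
  span-respectsᵣ {x} {y} x≈y (cs , x≈) = cs ,
    λ i → ≈-trans {y i} {x i} {linearCombination f cs i} (≈-sym {x i} {y i} (x≈y i)) (x≈ i)

  span-linearᵣ : Linear (Span f)
  span-linearᵣ c {x} {y} (cs , x≈) (ds , y≈) = List.map (map₁ (c *ᵣ_)) cs ++ ds , λ i →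
    ≈-trans {c *ᵣ x i +ᵣ y i} {c *ᵣ linearCombination f cs i +ᵣ linearCombination f ds i}
        {linearCombination f (List.map (map₁ (c *ᵣ_)) cs ++ ds) i}
      (+ᵣ-cong {c *ᵣ x i} {c *ᵣ linearCombination f cs i} {y i} {linearCombination f ds i}
        (*ᵣ-cong {c} {c} {x i} {linearCombination f cs i} (≈-refl {c}) (x≈ i)) (y≈ i))
      (≈-sym {linearCombination f (List.map (map₁ (c *ᵣ_)) cs ++ ds) i}
        {c *ᵣ linearCombination f cs i +ᵣ linearCombination f ds i} (linearCombination-linearᵣ c cs ds i))

  span-subspace : Subspace (Span f)
  span-subspace = (λ {x} {y} → span-respectsᵣ {x} {y}) , ([] , λ i → ≈-refl {0ᵣ}) , λ c {x} {y} → span-linearᵣ c {x} {y}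

  span-generator : ∀ a → Span f (f a)
  span-generator a = (1ᵣ , a) ∷ [] , λ i → pointwise⇒≈ {f a i} {1ᵣ *ᵣ f a i +ᵣ 0ᵣ}
    (λ n → sym (trans (ℚ.+-identityʳ _) (ℚ.*-identityˡ (approx (f a i) n))))

-- Integer points of a subspace

toℚ : ℤ → ℚ
toℚ k = k ℚ./ 1

toℚ-+ : ∀ a b → toℚ (a ℤ.+ b) ≡ toℚ a ℚ.+ toℚ b
toℚ-+ a b = ℚ.toℚᵘ-injective (begin
  ℚ.toℚᵘ (toℚ (a ℤ.+ b))                    ≈⟨ ℚ.toℚᵘ-fromℚᵘ (mkℚᵘ (a ℤ.+ b) 0) ⟩
  mkℚᵘ (a ℤ.+ b) 0                          ≈⟨ *≡* (lemma a b) ⟩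
  mkℚᵘ a 0 ℚᵘ.+ mkℚᵘ b 0                    ≈⟨ ℚᵘ.+-cong (ℚ.toℚᵘ-fromℚᵘ (mkℚᵘ a 0)) (ℚ.toℚᵘ-fromℚᵘ (mkℚᵘ b 0)) ⟨
  ℚ.toℚᵘ (toℚ a) ℚᵘ.+ ℚ.toℚᵘ (toℚ b)        ≈⟨ ℚ.toℚᵘ-homo-+ (toℚ a) (toℚ b) ⟨
  ℚ.toℚᵘ (toℚ a ℚ.+ toℚ b)                  ∎)
  where
  open ℚᵘ.≃-Reasoning
  lemma : ∀ a b → (a ℤ.+ b) ℤ.* 1ℤ ≡ (a ℤ.* 1ℤ ℤ.+ b ℤ.* 1ℤ) ℤ.* 1ℤ
  lemma = solve-∀

toℚ-* : ∀ a b → toℚ (a ℤ.* b) ≡ toℚ a ℚ.* toℚ b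
toℚ-* a b = ℚ.toℚᵘ-injective (begin
  ℚ.toℚᵘ (toℚ (a ℤ.* b))                    ≈⟨ ℚ.toℚᵘ-fromℚᵘ (mkℚᵘ (a ℤ.* b) 0) ⟩
  mkℚᵘ a 0 ℚᵘ.* mkℚᵘ b 0                    ≈⟨ ℚᵘ.*-cong (ℚ.toℚᵘ-fromℚᵘ (mkℚᵘ a 0)) (ℚ.toℚᵘ-fromℚᵘ (mkℚᵘ b 0)) ⟨
  ℚ.toℚᵘ (toℚ a) ℚᵘ.* ℚ.toℚᵘ (toℚ b)        ≈⟨ ℚ.toℚᵘ-homo-* (toℚ a) (toℚ b) ⟨
  ℚ.toℚᵘ (toℚ a ℚ.* toℚ b)                  ∎)
  where open ℚᵘ.≃-Reasoning

toℚ≢0 : ∀ {a} → a ≢ 0ℤ → toℚ a ≢ 0ℚ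
toℚ≢0 {a} a≢0 e with ℚ./-injective-≃ (mkℚᵘ a 0) (mkℚᵘ 0ℤ 0) e
... | *≡* a*1≡0 = a≢0 (trans (sym (ℤ.*-identityʳ a)) a*1≡0)

-- The bridge from real spans to integer elimination: purity holds because a nonzero integer is
-- invertible in ℚ. The reindexing `φ` lets matrices indexed by positions be read as tensors indexed
-- by coordinates.
integerPoints : ∀ {I J : Set} (φ : I → J) {Q : Pred (I → ℝ) 0ℓ} → Subspace Q →
  PureSubgroup (λ T → Q (λ i → fromℤ (T (φ i))))
integerPoints φ {Q} Q-sub = record
  { respects = λ {f} {g} f≗g → respectsᵣ Q-sub
      (λ i → pointwise⇒≈ {fromℤ (f (φ i))} {fromℤ (g (φ i))} (λ _ → cong toℚ (f≗g (φ i))))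
  ; zero∈    = respectsᵣ Q-sub (λ i → pointwise⇒≈ {0ᵣ} {fromℤ 0ℤ} (λ _ → refl)) (zero∈ᵣ Q-sub)
  ; linear   = λ α β {f} {g} f∈ g∈ → respectsᵣ Q-sub
      (λ i → pointwise⇒≈ {fromℤ α *ᵣ fromℤ (f (φ i)) +ᵣ (fromℤ β *ᵣ fromℤ (g (φ i)) +ᵣ 0ᵣ)}
        {fromℤ (α ℤ.* f (φ i) ℤ.+ β ℤ.* g (φ i))} (λ _ → expand α β (f (φ i)) (g (φ i))))
      (linearᵣ Q-sub (fromℤ α) {λ i → fromℤ (f (φ i))} {λ i → fromℤ β *ᵣ fromℤ (g (φ i)) +ᵣ 0ᵣ} f∈
        (linearᵣ Q-sub (fromℤ β) {λ i → fromℤ (g (φ i))} {λ _ → 0ᵣ} g∈ (zero∈ᵣ Q-sub)))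
  ; pure     = λ {α} {f} α≢0 αf∈ →
      let α⁻¹ = (ℚ.1/ toℚ α) {{ℚ.≢-nonZero (toℚ≢0 α≢0)}} in respectsᵣ Q-sub
      (λ i → pointwise⇒≈ {fromℚ α⁻¹ *ᵣ fromℤ (α ℤ.* f (φ i)) +ᵣ 0ᵣ} {fromℤ (f (φ i))}
        (λ _ → divide α (f (φ i)) {{ℚ.≢-nonZero (toℚ≢0 α≢0)}}))
      (linearᵣ Q-sub (fromℚ α⁻¹) {λ i → fromℤ (α ℤ.* f (φ i))} {λ _ → 0ᵣ} αf∈ (zero∈ᵣ Q-sub))
  }
  where
  expand : ∀ α β a b → toℚ α ℚ.* toℚ a ℚ.+ (toℚ β ℚ.* toℚ b ℚ.+ 0ℚ) ≡ toℚ (α ℤ.* a ℤ.+ β ℤ.* b)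
  expand α β a b = trans (cong (ℚ._+_ (toℚ α ℚ.* toℚ a)) (ℚ.+-identityʳ _))
    (sym (trans (toℚ-+ (α ℤ.* a) (β ℤ.* b)) (cong₂ ℚ._+_ (toℚ-* α a) (toℚ-* β b))))
  divide : ∀ α a .{{_ : ℚ.NonZero (toℚ α)}} → ℚ.1/ toℚ α ℚ.* toℚ (α ℤ.* a) ℚ.+ 0ℚ ≡ toℚ a
  divide α a = begin
    ℚ.1/ toℚ α ℚ.* toℚ (α ℤ.* a) ℚ.+ 0ℚ   ≡⟨ ℚ.+-identityʳ _ ⟩
    ℚ.1/ toℚ α ℚ.* toℚ (α ℤ.* a)          ≡⟨ cong (ℚ._*_ (ℚ.1/ toℚ α)) (toℚ-* α a) ⟩
    ℚ.1/ toℚ α ℚ.* (toℚ α ℚ.* toℚ a)      ≡⟨ ℚ.*-assoc (ℚ.1/ toℚ α) (toℚ α) (toℚ a) ⟨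
    (ℚ.1/ toℚ α ℚ.* toℚ α) ℚ.* toℚ a      ≡⟨ cong (ℚ._* toℚ a) (ℚ.*-inverseˡ (toℚ α)) ⟩
    1ℚ ℚ.* toℚ a                          ≡⟨ ℚ.*-identityˡ (toℚ a) ⟩
    toℚ a                                 ∎
    where open ≡-Reasoning

module _ {I J : Set} (F : (I → ℝ) → (J → ℝ))
  (F-cong   : ∀ {f g} → (∀ i → f i ≈ᵣ g i) → ∀ j → F f j ≈ᵣ F g j)
  (F-zero   : ∀ j n → approx (F (λ _ → 0ᵣ) j) n ≡ 0ℚ)
  (F-linear : ∀ c f g j n → approx (F (λ i → c *ᵣ f i +ᵣ g i) j) n ≡
    approx c n ℚ.* approx (F f j) n ℚ.+ approx (F g j) n)
  {Q : Pred (J → ℝ) 0ℓ} (Q-sub : Subspace Q) where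

  preimage : Subspace (λ f → Q (F f))
  preimage = (λ {f} {g} e → respectsᵣ Q-sub {F f} {F g} (F-cong e))
    , respectsᵣ Q-sub {λ _ → 0ᵣ} {F (λ _ → 0ᵣ)}
        (λ j → pointwise⇒≈ {0ᵣ} {F (λ _ → 0ᵣ) j} (λ n → sym (F-zero j n))) (zero∈ᵣ Q-sub)
    , λ c {f} {g} f∈ g∈ → respectsᵣ Q-sub {λ j → c *ᵣ F f j +ᵣ F g j} {F (λ i → c *ᵣ f i +ᵣ g i)}
        (λ j → pointwise⇒≈ {c *ᵣ F f j +ᵣ F g j} {F (λ i → c *ᵣ f i +ᵣ g i) j} (λ n → sym (F-linear c f g j n)))
        (linearᵣ Q-sub c {F f} {F g} f∈ g∈)

-- Perfection

symmetrise : ∀ {n} → Tensor n → Tensor n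
symmetrise t (i , j) = t (i , j) +ᵣ t (j , i)

module _ {n : ℕ} {Q : Pred (Tensor n) 0ℓ} (Q-sub : Subspace Q) where

  symmetrise-subspace : Subspace (λ t → Q (symmetrise t))
  symmetrise-subspace = preimage symmetrise
    (λ {t} {t′} e (i , j) → +ᵣ-cong {t (i , j)} {t′ (i , j)} {t (j , i)} {t′ (j , i)} (e (i , j)) (e (j , i)))
    (λ _ _ → refl)
    (λ c t t′ (i , j) n → lemma (approx c n) (approx (t (i , j)) n) (approx (t (j , i)) n)
      (approx (t′ (i , j)) n) (approx (t′ (j , i)) n))
    Q-sub
    where
    lemma : ∀ c a b a′ b′ → (c ℚ.* a ℚ.+ a′) ℚ.+ (c ℚ.* b ℚ.+ b′) ≡ c ℚ.* (a ℚ.+ b) ℚ.+ (a′ ℚ.+ b′)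
    lemma = RingSolver.solve-∀ ℚ-ring

  ⊗-subspaceˡ : ∀ w → Subspace (λ u → Q (u ⊗ w))
  ⊗-subspaceˡ w = preimage (_⊗ w)
    (λ {u} {u′} e (i , j) → *ᵣ-cong {u i} {u′ i} {w j} {w j} (e i) (≈-refl {w j}))
    (λ (i , j) n → ℚ.*-zeroˡ (approx (w j) n))
    (λ c u u′ (i , j) n → lemma (approx c n) (approx (u i) n) (approx (u′ i) n) (approx (w j) n))
    Q-sub
    where
    lemma : ∀ c a a′ b → (c ℚ.* a ℚ.+ a′) ℚ.* b ≡ c ℚ.* (a ℚ.* b) ℚ.+ a′ ℚ.* b
    lemma = RingSolver.solve-∀ ℚ-ring

  ⊗-subspaceʳ : ∀ u → Subspace (λ w → Q (u ⊗ w))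
  ⊗-subspaceʳ u = preimage (u ⊗_)
    (λ {w} {w′} e (i , j) → *ᵣ-cong {u i} {u i} {w j} {w′ j} (≈-refl {u i}) (e j))
    (λ (i , j) n → ℚ.*-zeroʳ (approx (u i) n))
    (λ c w w′ (i , j) n → lemma (approx c n) (approx (w j) n) (approx (w′ j) n) (approx (u i) n))
    Q-sub
    where
    lemma : ∀ c a a′ b → b ℚ.* (c ℚ.* a ℚ.+ a′) ≡ c ℚ.* (b ℚ.* a) ℚ.+ b ℚ.* a′
    lemma = RingSolver.solve-∀ ℚ-ring

symmetric-subspace : ∀ {n} → Subspace (SymmetricTensor {n})
symmetric-subspace =
    (λ {t} {t′} e t-sym i j → ≈-trans {t′ (i , j)} {t (i , j)} {t′ (j , i)} (≈-sym {t (i , j)} {t′ (i , j)} (e (i , j)))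
      (≈-trans {t (i , j)} {t (j , i)} {t′ (j , i)} (t-sym i j) (e (j , i))))
  , (λ _ _ → ≈-refl {0ᵣ})
  , λ c {t} {t′} t-sym t′-sym i j → +ᵣ-cong {c *ᵣ t (i , j)} {c *ᵣ t (j , i)} {t′ (i , j)} {t′ (j , i)}
      (*ᵣ-cong {c} {c} {t (i , j)} {t (j , i)} (≈-refl {c}) (t-sym i j)) (t′-sym i j)

module _ {n : ℕ} (L : Lattice n) where

  -- The spanning families are repeated verbatim from the definitions: naming them would force
  -- a comparison of reals, whose Cauchy proofs Agda then unfolds.

  MinimalSquares : Pred (Tensor n) 0ℓ
  MinimalSquares = Span {A = ∃ (IsMinimal L)} (λ (v , _) → real v ⊗ real v)

  minimalSquares-subspace : Subspace MinimalSquares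
  minimalSquares-subspace = span-subspace {A = ∃ (IsMinimal L)} (λ (v , _) → real v ⊗ real v)

  minimalSquare∈ : ∀ {v} → IsMinimal L v → MinimalSquares (real v ⊗ real v)
  minimalSquare∈ {v} v-min =
    span-generator {A = ∃ (IsMinimal L)} (λ (v , _) → real v ⊗ real v) (v , v-min)

  minimalSquares-least : ∀ {Q} → Subspace Q → (∀ v → IsMinimal L v → Q (real v ⊗ real v)) →
    MinimalSquares ⊆ Q
  minimalSquares-least Q-sub gen {t} = span-least {A = ∃ (IsMinimal L)}
    (λ (v , _) → real v ⊗ real v) Q-sub (λ (v , v-min) → gen v v-min) {t}

  point∈ : ∀ {x} → L x → (L ⊗ℝ) (real x)
  point∈ {x} x∈ = span-generator {A = ∃ L} (λ (x , _) → real x) (x , x∈)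

  ⊗ℝ-least : ∀ {Q} → Subspace Q → (∀ x → L x → Q (real x)) → (L ⊗ℝ) ⊆ Q
  ⊗ℝ-least Q-sub gen {u} = span-least {A = ∃ L} (λ (x , _) → real x) Q-sub (λ (x , x∈) → gen x x∈) {u}

  tensorSquare-subspace : Subspace (TensorSquare L)
  tensorSquare-subspace = span-subspace {A = ∃ (L ⊗ℝ) × ∃ (L ⊗ℝ)} (λ ((u , _) , (w , _)) → u ⊗ w)

  tensor∈ : ∀ {u w} → (L ⊗ℝ) u → (L ⊗ℝ) w → TensorSquare L (u ⊗ w)
  tensor∈ {u} {w} u∈ w∈ = span-generator {A = ∃ (L ⊗ℝ) × ∃ (L ⊗ℝ)}
    (λ ((u , _) , (w , _)) → u ⊗ w) ((u , u∈) , (w , w∈))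

  tensorSquare-least : ∀ {Q} → Subspace Q → (∀ u w → (L ⊗ℝ) u → (L ⊗ℝ) w → Q (u ⊗ w)) →
    TensorSquare L ⊆ Q
  tensorSquare-least Q-sub gen {t} = span-least {A = ∃ (L ⊗ℝ) × ∃ (L ⊗ℝ)}
    (λ ((u , _) , (w , _)) → u ⊗ w) Q-sub (λ ((u , u∈) , (w , w∈)) → gen u w u∈ w∈) {t}

  minimalSquares⊆ : MinimalSquares ⊆ (TensorSquare L ∩ SymmetricTensor)
  minimalSquares⊆ {t} t∈ =
      minimalSquares-least tensorSquare-subspace
        (λ v v-min → tensor∈ {real v} {real v} (point∈ (proj₁ v-min)) (point∈ (proj₁ v-min))) {t} t∈
    , minimalSquares-least symmetric-subspace
        (λ v _ i j → pointwise⇒≈ {real v i *ᵣ real v j} {real v j *ᵣ real v i}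
          (λ _ → ℚ.*-comm (toℚ (v i)) (toℚ (v j)))) {t} t∈

  module _ (products∈span : ∀ {x y} → L x → L y →
    MinimalSquares (λ (i , j) → fromℤ (x i ℤ.* y j ℤ.+ y i ℤ.* x j))) where

    -- For fixed `w` the condition on `u` defines a subspace, and likewise with the roles exchanged,
    -- so it only has to be checked on the lattice vectors spanning `L ⊗ℝ`.
    symmetricProduct∈ : ∀ {u w} → (L ⊗ℝ) u → (L ⊗ℝ) w → MinimalSquares (symmetrise (u ⊗ w))
    symmetricProduct∈ {u} {w} u∈ w∈ = ⊗ℝ-least (⊗-subspaceˡ sub w)
      (λ x x∈ → ⊗ℝ-least (⊗-subspaceʳ sub (real x))
        (λ y y∈ → respectsᵣ minimalSquares-subspace
          {λ (i , j) → fromℤ (x i ℤ.* y j ℤ.+ y i ℤ.* x j)} {symmetrise (real x ⊗ real y)}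
          (λ (i , j) → pointwise⇒≈ {fromℤ (x i ℤ.* y j ℤ.+ y i ℤ.* x j)}
            {real x i *ᵣ real y j +ᵣ real x j *ᵣ real y i}
            (λ _ → expand (x i) (y j) (y i) (x j)))
          (products∈span {x} {y} x∈ y∈)) {w} w∈) {u} u∈
      where
      sub = symmetrise-subspace minimalSquares-subspace
      expand : ∀ a b c e → toℚ (a ℤ.* b ℤ.+ c ℤ.* e) ≡ toℚ a ℚ.* toℚ b ℚ.+ toℚ e ℚ.* toℚ c
      expand a b c e = trans (toℚ-+ (a ℤ.* b) (c ℤ.* e))
        (cong₂ ℚ._+_ (toℚ-* a b) (trans (toℚ-* c e) (ℚ.*-comm (toℚ c) (toℚ e))))

    -- A symmetric tensor is half its own symmetrisation, and symmetrisation, unlike the tensor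
    -- itself, can be treated generator by generator: the individual `u ⊗ w` need not be symmetric.
    ⊆minimalSquares : (TensorSquare L ∩ SymmetricTensor) ⊆ MinimalSquares
    ⊆minimalSquares {t} (t∈ , t-sym) = respectsᵣ minimalSquares-subspace
      {λ ij → ½ᵣ *ᵣ symmetrise t ij +ᵣ 0ᵣ} {t}
      (λ (i , j) → ≈-trans {½ᵣ *ᵣ symmetrise t (i , j) +ᵣ 0ᵣ} {½ᵣ *ᵣ (t (i , j) +ᵣ t (i , j)) +ᵣ 0ᵣ} {t (i , j)}
        (+ᵣ-cong {½ᵣ *ᵣ symmetrise t (i , j)} {½ᵣ *ᵣ (t (i , j) +ᵣ t (i , j))} {0ᵣ} {0ᵣ}
          (*ᵣ-cong {½ᵣ} {½ᵣ} {symmetrise t (i , j)} {t (i , j) +ᵣ t (i , j)} (≈-refl {½ᵣ})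
            (+ᵣ-cong {t (i , j)} {t (i , j)} {t (j , i)} {t (i , j)} (≈-refl {t (i , j)}) (t-sym j i)))
          (≈-refl {0ᵣ}))
        (pointwise⇒≈ {½ᵣ *ᵣ (t (i , j) +ᵣ t (i , j)) +ᵣ 0ᵣ} {t (i , j)} (λ n → halve (approx (t (i , j)) n))))
      (linearᵣ minimalSquares-subspace ½ᵣ {symmetrise t} {λ _ → 0ᵣ}
        (tensorSquare-least (symmetrise-subspace minimalSquares-subspace)
          (λ u w u∈ w∈ → symmetricProduct∈ {u} {w} u∈ w∈) {t} t∈)
        (zero∈ᵣ minimalSquares-subspace))
      where
      halve : ∀ a → ½ ℚ.* (a ℚ.+ a) ℚ.+ 0ℚ ≡ a
      halve a = trans (ℚ.+-identityʳ _) (trans (ℚ.*-distribˡ-+ ½ a a)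
        (trans (sym (ℚ.*-distribʳ-+ a ½ ½)) (ℚ.*-identityˡ a)))

    perfect : Perfect L
    perfect = (λ {t} → minimalSquares⊆ {t}) , (λ {t} → ⊆minimalSquares {t})

-- From corner squares to perfection

module Perfection (d : ℕ) (10≤d : 10 ≤ d) (h : Sequence) (apart : Consecutive Apart h) where

  open Nonholes d 10≤d h apart
  open NonHoles (_∈ₛ h) (hole? h apart) (holes-spaced h apart)
  open Core (_∈ₛ h) (hole? h apart) (holes-spaced h apart) (2 + d)

  private
    L = L[ d ] h

  -- The induction works with functions on all positions; only their entries at the first d + 2
  -- non-holes are tested here.
  InSpan : Pred (ℕ × ℕ → ℤ) 0ℓ
  InSpan T = MinimalSquares L (λ (i , j) → fromℤ (T (σ i , σ j)))

  InSpan-pure : PureSubgroup InSpan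
  InSpan-pure = integerPoints (λ (i , j) → σ i , σ j) (minimalSquares-subspace L)

  -- `u ⊙ u` is twice the tensor square, hence the square of the minimal vector added to itself.
  corner∈ : ∀ {w x y z} → NonHoleFrom 0 w → NonHoleFrom 0 x → NonHoleFrom 0 y → NonHoleFrom 0 z →
    Corners w x y z → InSpan (⟦ corner w x y z ⟧ ⊙ ⟦ corner w x y z ⟧)
  corner∈ {w} {x} {y} {z} w∈ x∈ y∈ z∈ c = respectsᵣ (minimalSquares-subspace L)
    {λ ij → 1ᵣ *ᵣ square ij +ᵣ square ij} {λ (i , j) → fromℤ ((u ⊙ u) (σ i , σ j))}
    (λ (i , j) → pointwise⇒≈ {1ᵣ *ᵣ square (i , j) +ᵣ square (i , j)} {fromℤ ((u ⊙ u) (σ i , σ j))}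
      (λ _ → double (u (σ i)) (u (σ j))))
    (linearᵣ (minimalSquares-subspace L) 1ᵣ {square} {square} square∈ square∈)
    where
    u = ⟦ corner w x y z ⟧
    square : Tensor (2 + d)
    square = real (u ∘ σ) ⊗ real (u ∘ σ)
    square∈ : MinimalSquares L square
    square∈ = minimalSquare∈ L {u ∘ σ} (corner-minimal w∈ x∈ y∈ z∈ c)
    double : ∀ a b → 1ℚ ℚ.* (toℚ a ℚ.* toℚ b) ℚ.+ toℚ a ℚ.* toℚ b ≡ toℚ (a ℤ.* b ℤ.+ a ℤ.* b)
    double a b = trans (cong (ℚ._+ toℚ a ℚ.* toℚ b) (ℚ.*-identityˡ (toℚ a ℚ.* toℚ b)))
      (sym (trans (toℚ-+ (a ℤ.* b) (a ℤ.* b)) (cong₂ ℚ._+_ (toℚ-* a b) (toℚ-* a b))))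

  products∈span : ∀ {x y} → L x → L y → MinimalSquares L (λ (i , j) → fromℤ (x i ℤ.* y j ℤ.+ y i ℤ.* x j))
  products∈span {x} {y} x∈ y∈ = respectsᵣ (minimalSquares-subspace L)
    {λ (i , j) → fromℤ ((⟦ combination x ⟧ ⊙ ⟦ combination y ⟧) (σ i , σ j))}
    {λ (i , j) → fromℤ (x i ℤ.* y j ℤ.+ y i ℤ.* x j)}
    (λ (i , j) → pointwise⇒≈ {fromℤ ((⟦ combination x ⟧ ⊙ ⟦ combination y ⟧) (σ i , σ j))}
      {fromℤ (x i ℤ.* y j ℤ.+ y i ℤ.* x j)}
      (λ _ → cong toℚ (cong₂ ℤ._+_
        (cong₂ ℤ._*_ (combination-value x i) (combination-value y j))
        (cong₂ ℤ._*_ (combination-value y i) (combination-value x j)))))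
    -- The last twelve of the d + 2 non-holes are the base, so d - 10 steps lead down to the lowest
    -- one.
    (vanishing InSpan-pure corner∈ (d ∸ 10) 0
      (trans (ℕ.+-comm (d ∸ 10) 12) (cong (2 ℕ.+_) (ℕ.m+[n∸m]≡n 10≤d)))
      (combination-relation {x} x∈) (combination-relation {y} y∈))

  L-perfect : Perfect L
  L-perfect = perfect L (λ {x} {y} → products∈span {x} {y})

theorem3p1 : (d : ℕ) → 10 ≤ d →
    (h : Sequence) →
    AllTerms (λ a → 0 < a) h →
    Consecutive _<_ h →
    Consecutive (λ a b → a + 6 ≤ b) h →
    Perfect (L[ d ] h) × HasMinimum (L[ d ] h) (+ 4)
theorem3p1 d 10≤d h _ _ apart =
  Perfection.L-perfect d 10≤d h apart , Nonholes.hasMinimum d 10≤d h apart
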